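{- Let $k\ge 1$ be an integer and let $\gamma_k<2$ be the largest real root of the equation $x^{k+3}-2x^{k+2}+1=0$. Let $G$ be a graph with $n$ vertices, and let $P_1$ be the time complexity of performing steps (1)–(3) of the procedure $\mathsf{BB}$ (defined in the context) once, that is, the reduction step, the termination test and the choice of the branching vertex, without the recursive calls; $P_1$ is polynomial in $n$. Then the time complexity of the algorithm $\mathsf{kDC\text{ - }t}$ (defined in the context) on input $(G,k)$ is $\mathcal{O}(P_1\cdot\gamma_k^{n})$, and hence $\mathcal{O}^*(\gamma_k^n)$.
   Context: All graphs are finite, simple, undirected and unweighted. For a graph $g$, $V(g)$ is its vertex set, $d_g(u)$ is the degree of $u$ in $g$, and a non-edge of $g$ is an unordered pair of distinct non-adjacent vertices. For $S\subseteq V(g)$, $\overline{E}(S)$ denotes the set of non-edges of the subgraph of $g$ induced by $S$. A graph is a $k$-defective clique if it has at most $k$ non-edges; a vertex set $S\subseteq V(g)$ is called a $k$-defective clique if $|\overline{E}(S)|\le k$. The maximum $k$-defective clique problem asks, given $G$ and $k$, for a $k$-defective clique $C\subseteq V(G)$ of maximum cardinality. A non-neighbor of $u$ is a vertex different from $u$ and not adjacent to $u$. $S\cup u$ means $S\cup\{u\}$, and $g\setminus b$ is $g$ with the vertex $b$ deleted. The notation $\mathcal{O}^*$ hides factors polynomial in $n$. An instance is a pair $(g,S)$ with $g$ a graph and $S\subseteq V(g)$ a $k$-defective clique. Algorithm $\mathsf{kDC\text{ - }t}(G,k)$: set $C^*\leftarrow\emptyset$, run $\mathsf{BB}(G,\emptyset)$,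 and return $C^*$. Procedure $\mathsf{BB}(g,S)$: (1) Exhaustively apply (until neither is applicable) the following two reduction rules to $(g,S)$, giving $(g',S')$. RR1: if $u\in V(g)\setminus S$ satisfies $|\overline{E}(S\cup u)|>k$, delete $u$ from $g$. RR2: if $u\in V(g)\setminus S$ satisfies $|\overline{E}(S\cup u)|\le k$ and $d_g(u)\ge |V(g)|-2$, add $u$ to $S$. (2) If $g'$ is a $k$-defective clique, update $C^*$ by $V(g')$ (that is, replace $C^*$ by $V(g')$ if $V(g')$ is larger) and return. (3) Otherwise choose a branching vertex $b\in V(g')\setminus S'$ that has at least one non-neighbor in $S'$; if no such vertex exists, let $b$ be an arbitrary vertex of $V(g')\setminus S'$. (4) Call $\mathsf{BB}(g',S'\cup b)$ and then $\mathsf{BB}(g'\setminus b,S')$. -}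

module Defs where

open import Data.Bool using (Bool; true; false)
import Data.Bool.Properties as Bool
open import Data.Fin using (Fin)
import Data.Fin as Fin
import Data.Fin.Properties as Fin
open import Data.Fin.Subset
open import Data.Fin.Subset.Properties
open import Data.Integer using (+_)
open import Data.List using (List; length; filter; cartesianProduct; allFin)
import Data.List.Properties as List
import Data.List.Relation.Unary.All as All
open import Data.Nat using (ℕ; zero; suc; _+_; _*_; _∸_; _^_; _⊔_; _≤_; _<_; _≤?_; z≤n)
import Data.Nat.Properties as ℕ
open import Data.Nat.Induction using (Acc; acc; <-wellFounded)
open import Data.Product using (Σ-syntax; ∃-syntax; _×_; _,_; proj₁; proj₂)
open import Data.Rational as ℚ using (ℚ; 0ℚ; 1ℚ; ½)
import Data.Rational.Properties as ℚ
open import Data.Rational.Solver using (module +-*-Solver)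
open import Data.Sum using (_⊎_; inj₁; inj₂)
open import Data.Vec using (tabulate; []; _∷_; here; there)
open import Relation.Binary.Construct.Closure.ReflexiveTransitive as Star using (Star; _◅_)
open import Relation.Binary.PropositionalEquality
  using (_≡_; _≢_; refl; sym; trans; cong; cong₂; subst)
open import Relation.Nullary using (¬_; Dec; yes; no; ¬?; contradiction)
open import Relation.Nullary.Decidable using (_×-dec_)
open import Relation.Unary using (Pred; Decidable)

-- Real numbers: Cauchy sequences of rationals, with the operations
-- taken termwise and equality and order taken in the limit.

IsCauchy : (ℕ → ℚ) → Set
IsCauchy x = ∀ ε → 0ℚ ℚ.< ε →
  Σ[ N ∈ ℕ ] (∀ m n → N ≤ m → N ≤ n → ℚ.∣ x m ℚ.- x n ∣ ℚ.≤ ε)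

record ℝ : Set where
  constructor mkℝ
  field
    seq    : ℕ → ℚ
    cauchy : IsCauchy seq

open ℝ public

infix 4 _≃ᴿ_ _≤ᴿ_ _<ᴿ_

_≃ᴿ_ : ℝ → ℝ → Set
x ≃ᴿ y = ∀ ε → 0ℚ ℚ.< ε →
  Σ[ N ∈ ℕ ] (∀ n → N ≤ n → ℚ.∣ seq x n ℚ.- seq y n ∣ ℚ.≤ ε)

_≤ᴿ_ : ℝ → ℝ → Set
x ≤ᴿ y = ∀ ε → 0ℚ ℚ.< ε →
  Σ[ N ∈ ℕ ] (∀ n → N ≤ n → seq x n ℚ.≤ seq y n ℚ.+ ε)

_<ᴿ_ : ℝ → ℝ → Set
x <ᴿ y = Σ[ ε ∈ ℚ ] 0ℚ ℚ.< ε ×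
  (Σ[ N ∈ ℕ ] (∀ n → N ≤ n → seq x n ℚ.+ ε ℚ.≤ seq y n))

halves : ∀ ε → ½ ℚ.* ε ℚ.+ ½ ℚ.* ε ≡ ε
halves ε = trans (sym (ℚ.*-distribʳ-+ ε ½ ½)) (ℚ.*-identityˡ ε)

*-pos : ∀ {p q} → 0ℚ ℚ.< p → 0ℚ ℚ.< q → 0ℚ ℚ.< p ℚ.* q
*-pos {p} {q} 0<p 0<q =
  subst (ℚ._< p ℚ.* q) (ℚ.*-zeroʳ p)
    (ℚ.*-monoʳ-<-pos p {{ℚ.positive 0<p}} 0<q)

half-pos : ∀ {ε} → 0ℚ ℚ.< ε → 0ℚ ℚ.< ½ ℚ.* ε
half-pos = *-pos (ℚ.positive⁻¹ ½)

+-cauchy : ∀ x y → IsCauchy x → IsCauchy y → IsCauchy (λ n → x n ℚ.+ y n)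
+-cauchy x y cx cy ε 0<ε
  with cx (½ ℚ.* ε) (half-pos 0<ε) | cy (½ ℚ.* ε) (half-pos 0<ε)
... | N , hx | M , hy = N ⊔ M , λ m n m≥ n≥ → begin
    ℚ.∣ (x m ℚ.+ y m) ℚ.- (x n ℚ.+ y n) ∣
      ≡⟨ cong ℚ.∣_∣ (regroup (x m) (y m) (x n) (y n)) ⟩
    ℚ.∣ (x m ℚ.- x n) ℚ.+ (y m ℚ.- y n) ∣
      ≤⟨ ℚ.∣p+q∣≤∣p∣+∣q∣ (x m ℚ.- x n) (y m ℚ.- y n) ⟩
    ℚ.∣ x m ℚ.- x n ∣ ℚ.+ ℚ.∣ y m ℚ.- y n ∣
      ≤⟨ ℚ.+-mono-≤
           (hx m n (ℕ.m⊔n≤o⇒m≤o N M m≥) (ℕ.m⊔n≤o⇒m≤o N M n≥))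
           (hy m n (ℕ.m⊔n≤o⇒n≤o N M m≥) (ℕ.m⊔n≤o⇒n≤o N M n≥)) ⟩
    ½ ℚ.* ε ℚ.+ ½ ℚ.* ε
      ≡⟨ halves ε ⟩
    ε ∎
  where
  open ℚ.≤-Reasoning
  open +-*-Solver
  regroup : ∀ a b c d →
    (a ℚ.+ b) ℚ.- (c ℚ.+ d) ≡ (a ℚ.- c) ℚ.+ (b ℚ.- d)
  regroup = solve 4 (λ a b c d →
    (a :+ b) :- (c :+ d) := (a :- c) :+ (b :- d)) refl

neg-cauchy : ∀ x → IsCauchy x → IsCauchy (λ n → ℚ.- x n)
neg-cauchy x cx ε 0<ε with cx ε 0<ε
... | N , h = N , λ m n m≥ n≥ →
  subst (ℚ._≤ ε)
    (trans (sym (ℚ.∣-p∣≡∣p∣ (x m ℚ.- x n))) (cong ℚ.∣_∣ (regroup (x m) (x n))))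
    (h m n m≥ n≥)
  where
  open +-*-Solver
  regroup : ∀ a b → ℚ.- (a ℚ.- b) ≡ (ℚ.- a) ℚ.- (ℚ.- b)
  regroup = solve 2 (λ a b → :- (a :- b) := (:- a) :- (:- b)) refl

bounded : ∀ x → IsCauchy x →
  Σ[ B ∈ ℚ ] 0ℚ ℚ.< B × (Σ[ N ∈ ℕ ] (∀ n → N ≤ n → ℚ.∣ x n ∣ ℚ.≤ B))
bounded x cx with cx 1ℚ (ℚ.positive⁻¹ 1ℚ)
... | N , h = 1ℚ ℚ.+ ℚ.∣ x N ∣
            , ℚ.+-mono-<-≤ (ℚ.positive⁻¹ 1ℚ) (ℚ.0≤∣p∣ (x N))
            , N , λ n n≥ → begin
    ℚ.∣ x n ∣
      ≡⟨ cong ℚ.∣_∣ (regroup (x n) (x N)) ⟩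
    ℚ.∣ (x n ℚ.- x N) ℚ.+ x N ∣
      ≤⟨ ℚ.∣p+q∣≤∣p∣+∣q∣ (x n ℚ.- x N) (x N) ⟩
    ℚ.∣ x n ℚ.- x N ∣ ℚ.+ ℚ.∣ x N ∣
      ≤⟨ ℚ.+-monoˡ-≤ ℚ.∣ x N ∣ (h n N n≥ ℕ.≤-refl) ⟩
    1ℚ ℚ.+ ℚ.∣ x N ∣ ∎
  where
  open ℚ.≤-Reasoning
  open +-*-Solver
  regroup : ∀ a b → a ≡ (a ℚ.- b) ℚ.+ b
  regroup = solve 2 (λ a b → a := (a :- b) :+ b) refl

*-mono-∣∣ : ∀ p q {a b} → ℚ.∣ p ∣ ℚ.≤ a → ℚ.∣ q ∣ ℚ.≤ b → ℚ.∣ p ℚ.* q ∣ ℚ.≤ a ℚ.* b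
*-mono-∣∣ p q {a} {b} p≤a q≤b = begin
  ℚ.∣ p ℚ.* q ∣
    ≡⟨ ℚ.∣p*q∣≡∣p∣*∣q∣ p q ⟩
  ℚ.∣ p ∣ ℚ.* ℚ.∣ q ∣
    ≤⟨ ℚ.*-monoʳ-≤-nonNeg ℚ.∣ q ∣ {{ℚ.∣-∣-nonNeg q}} p≤a ⟩
  a ℚ.* ℚ.∣ q ∣
    ≤⟨ ℚ.*-monoˡ-≤-nonNeg a
         {{ℚ.nonNegative (ℚ.≤-trans (ℚ.0≤∣p∣ p) p≤a)}} q≤b ⟩
  a ℚ.* b ∎
  where open ℚ.≤-Reasoning

scale : ∀ B ε → 0ℚ ℚ.< B → 0ℚ ℚ.< ε → Σ[ δ ∈ ℚ ] 0ℚ ℚ.< δ × B ℚ.* δ ≡ ε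
scale B ε 0<B 0<ε = (ℚ.1/ B) ℚ.* ε
                  , *-pos (ℚ.positive⁻¹ (ℚ.1/ B) {{ℚ.1/pos⇒pos B}}) 0<ε
                  , trans (sym (ℚ.*-assoc B (ℚ.1/ B) ε))
                      (trans (cong (ℚ._* ε) (ℚ.*-inverseʳ B)) (ℚ.*-identityˡ ε))
  where
  instance
    B-pos : ℚ.Positive B
    B-pos = ℚ.positive 0<B
    B-nonZero : ℚ.NonZero B
    B-nonZero = ℚ.pos⇒nonZero B

*-cauchy : ∀ x y → IsCauchy x → IsCauchy y → IsCauchy (λ n → x n ℚ.* y n)
*-cauchy x y cx cy ε 0<ε =
  let A , 0<A , Na , ha = bounded x cx
      B , 0<B , Nb , hb = bounded y cy
      δ , 0<δ , Aδ      = scale A (½ ℚ.* ε) 0<A (half-pos 0<ε)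
      η , 0<η , Bη      = scale B (½ ℚ.* ε) 0<B (half-pos 0<ε)
      N , hy            = cy δ 0<δ
      M , hx            = cx η 0<η
      inA = λ {i} (i≥ : (Na ⊔ Nb) ⊔ (N ⊔ M) ≤ i) →
              ℕ.m⊔n≤o⇒m≤o Na Nb (ℕ.m⊔n≤o⇒m≤o (Na ⊔ Nb) (N ⊔ M) i≥)
      inB = λ {i} (i≥ : (Na ⊔ Nb) ⊔ (N ⊔ M) ≤ i) →
              ℕ.m⊔n≤o⇒n≤o Na Nb (ℕ.m⊔n≤o⇒m≤o (Na ⊔ Nb) (N ⊔ M) i≥)
      inN = λ {i} (i≥ : (Na ⊔ Nb) ⊔ (N ⊔ M) ≤ i) →
              ℕ.m⊔n≤o⇒m≤o N M (ℕ.m⊔n≤o⇒n≤o (Na ⊔ Nb) (N ⊔ M) i≥)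
      inM = λ {i} (i≥ : (Na ⊔ Nb) ⊔ (N ⊔ M) ≤ i) →
              ℕ.m⊔n≤o⇒n≤o N M (ℕ.m⊔n≤o⇒n≤o (Na ⊔ Nb) (N ⊔ M) i≥)
  in (Na ⊔ Nb) ⊔ (N ⊔ M) , λ m n m≥ n≥ →
       product-close A δ B η (x m) (y m) (x n) (y n) Aδ Bη
         (ha m (inA m≥)) (hy m n (inN m≥) (inN n≥))
         (hb n (inB n≥)) (hx m n (inM m≥) (inM n≥))
  where
  open ℚ.≤-Reasoning
  open +-*-Solver
  regroup : ∀ a b c d →
    (a ℚ.* b) ℚ.- (c ℚ.* d) ≡ a ℚ.* (b ℚ.- d) ℚ.+ d ℚ.* (a ℚ.- c)
  regroup = solve 4 (λ a b c d →
    (a :* b) :- (c :* d) := a :* (b :- d) :+ d :* (a :- c)) refl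

  product-close : ∀ A δ B η a b c d → A ℚ.* δ ≡ ½ ℚ.* ε → B ℚ.* η ≡ ½ ℚ.* ε →
    ℚ.∣ a ∣ ℚ.≤ A → ℚ.∣ b ℚ.- d ∣ ℚ.≤ δ → ℚ.∣ d ∣ ℚ.≤ B → ℚ.∣ a ℚ.- c ∣ ℚ.≤ η →
    ℚ.∣ (a ℚ.* b) ℚ.- (c ℚ.* d) ∣ ℚ.≤ ε
  product-close A δ B η a b c d Aδ Bη ∣a∣≤ ∣b-d∣≤ ∣d∣≤ ∣a-c∣≤ = begin
    ℚ.∣ (a ℚ.* b) ℚ.- (c ℚ.* d) ∣
      ≡⟨ cong ℚ.∣_∣ (regroup a b c d) ⟩
    ℚ.∣ a ℚ.* (b ℚ.- d) ℚ.+ d ℚ.* (a ℚ.- c) ∣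
      ≤⟨ ℚ.∣p+q∣≤∣p∣+∣q∣ (a ℚ.* (b ℚ.- d)) (d ℚ.* (a ℚ.- c)) ⟩
    ℚ.∣ a ℚ.* (b ℚ.- d) ∣ ℚ.+ ℚ.∣ d ℚ.* (a ℚ.- c) ∣
      ≤⟨ ℚ.+-mono-≤ (*-mono-∣∣ a (b ℚ.- d) ∣a∣≤ ∣b-d∣≤)
                    (*-mono-∣∣ d (a ℚ.- c) ∣d∣≤ ∣a-c∣≤) ⟩
    A ℚ.* δ ℚ.+ B ℚ.* η
      ≡⟨ cong₂ ℚ._+_ Aδ Bη ⟩
    ½ ℚ.* ε ℚ.+ ½ ℚ.* ε
      ≡⟨ halves ε ⟩
    ε ∎

fromℚᴿ : ℚ → ℝ
fromℚᴿ q = mkℝ (λ _ → q) λ ε 0<ε →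
  0 , λ _ _ _ _ → subst (λ d → ℚ.∣ d ∣ ℚ.≤ ε) (sym (ℚ.+-inverseʳ q)) (ℚ.<⇒≤ 0<ε)

fromℕᴿ : ℕ → ℝ
fromℕᴿ m = fromℚᴿ (+ m ℚ./ 1)

infixl 6 _+ᴿ_ _-ᴿ_
infixl 7 _*ᴿ_
infixr 8 _^ᴿ_

_+ᴿ_ : ℝ → ℝ → ℝ
x +ᴿ y = mkℝ (λ n → seq x n ℚ.+ seq y n) (+-cauchy (seq x) (seq y) (cauchy x) (cauchy y))

_*ᴿ_ : ℝ → ℝ → ℝ
x *ᴿ y = mkℝ (λ n → seq x n ℚ.* seq y n) (*-cauchy (seq x) (seq y) (cauchy x) (cauchy y))

-ᴿ_ : ℝ → ℝ
-ᴿ x = mkℝ (λ n → ℚ.- seq x n) (neg-cauchy (seq x) (cauchy x))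

_-ᴿ_ : ℝ → ℝ → ℝ
x -ᴿ y = x +ᴿ (-ᴿ y)

_^ᴿ_ : ℝ → ℕ → ℝ
x ^ᴿ zero  = fromℕᴿ 1
x ^ᴿ suc m = x *ᴿ x ^ᴿ m

IsLargestRoot : (ℝ → ℝ) → ℝ → Set
IsLargestRoot p r = p r ≃ᴿ fromℕᴿ 0 × (∀ x → p x ≃ᴿ fromℕᴿ 0 → x ≤ᴿ r)

-- For x ≢ 1, a zero means x^(k+2) = x^(k+1) + … + x + 1: multiply by x - 1.
branchingPoly : ℕ → ℝ → ℝ
branchingPoly k x = x ^ᴿ (k + 3) -ᴿ fromℕᴿ 2 *ᴿ x ^ᴿ (k + 2) +ᴿ fromℕᴿ 1

record Graph (n : ℕ) : Set where
  field
    adj       : Fin n → Fin n → Bool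
    symmetric : ∀ u v → adj u v ≡ adj v u
    loopless  : ∀ u → adj u u ≡ false

-- Every graph g occurring in the algorithm is an induced subgraph of the
-- input graph G, and is represented by its vertex set.

module _ {n : ℕ} (G : Graph n) where
  open Graph G

  -- An unordered pair of distinct vertices is listed once, smaller vertex first.
  IsNonEdgeIn : Subset n → Pred (Fin n × Fin n) _
  IsNonEdgeIn S (u , v) = u Fin.< v × u ∈ S × v ∈ S × adj u v ≡ false

  isNonEdgeIn? : ∀ S → Decidable (IsNonEdgeIn S)
  isNonEdgeIn? S (u , v) =
    (u Fin.<? v) ×-dec (u ∈? S) ×-dec (v ∈? S) ×-dec (adj u v Bool.≟ false)

  nonEdges : Subset n → List (Fin n × Fin n)
  nonEdges S = filter (isNonEdgeIn? S) (cartesianProduct (allFin n) (allFin n))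

  ∣Ē_∣ : Subset n → ℕ
  ∣Ē S ∣ = length (nonEdges S)

  IsDefectiveClique : ℕ → Subset n → Set
  IsDefectiveClique k S = ∣Ē S ∣ ≤ k

  isDefectiveClique? : ∀ k S → Dec (IsDefectiveClique k S)
  isDefectiveClique? k S = ∣Ē S ∣ ≤? k

  degreeIn : Subset n → Fin n → ℕ
  degreeIn V u = ∣ V ∩ tabulate (adj u) ∣

  HasNonNeighborIn : Subset n → Fin n → Set
  HasNonNeighborIn S u = ∃[ v ] v ∈ S × v ≢ u × adj u v ≡ false

module _ (k : ℕ) {n : ℕ} (G : Graph n) where

  record Instance : Set where
    field
      V         : Subset n
      S         : Subset n
      S⊆V       : S ⊆ V
      defective : IsDefectiveClique G k S

  open Instance

  RR1-applies : Instance → Fin n → Set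
  RR1-applies I u = u ∈ V I × u ∉ S I × k < ∣Ē_∣ G (S I ∪ ⁅ u ⁆)

  RR2-applies : Instance → Fin n → Set
  RR2-applies I u = u ∈ V I × u ∉ S I × ∣Ē_∣ G (S I ∪ ⁅ u ⁆) ≤ k
                  × ∣ V I ∣ ∸ 2 ≤ degreeIn G (V I) u

  data _⟶_ (I J : Instance) : Set where
    rr1 : ∀ u → RR1-applies I u → V J ≡ V I - u → S J ≡ S I → I ⟶ J
    rr2 : ∀ u → RR2-applies I u → V J ≡ V I → S J ≡ S I ∪ ⁅ u ⁆ → I ⟶ J

  _⟶*_ : Instance → Instance → Set
  _⟶*_ = Star _⟶_

  Irreducible : Instance → Set
  Irreducible I = ∀ u → ¬ RR1-applies I u × ¬ RR2-applies I u

  IsBranchingVertex : Instance → Fin n → Set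
  IsBranchingVertex I b =
    b ∈ V I × b ∉ S I ×
    (HasNonNeighborIn G (S I) b
      ⊎ (∀ u → u ∈ V I → u ∉ S I → ¬ HasNonNeighborIn G (S I) u))

  -- The procedure leaves open in which order the rules are applied, which
  -- branching vertex is taken, and how steps (1)–(3) are carried out; these
  -- data fix all of that.  `cost I C*` is the time spent on steps (1)–(3) at
  -- the instance I when C* is the best clique found so far, including the
  -- update of C* in step (2).
  record Implementation : Set where
    field
      reduce      : Instance → Instance
      reduces     : ∀ I → I ⟶* reduce I
      irreducible : ∀ I → Irreducible (reduce I)
      branch      : ∀ I → Irreducible I → ¬ IsDefectiveClique G k (V I) → Fin n
      branching   : ∀ I irr ¬def → IsBranchingVertex I (branch I irr ¬def)
      cost        : Instance → Subset n → ℕ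
      cost-pos    : ∀ I C* → 1 ≤ cost I C*

  initial : Instance
  initial = record
    { V = ⊤ ; S = ⊥ ; S⊆V = ⊆-max ⊥
    ; defective = subst (_≤ k) (sym (cong length
        (List.filter-none (isNonEdgeIn? G ⊥)
          (All.universal (λ { _ (_ , u∈⊥ , _) → ∉⊥ u∈⊥ })
            (cartesianProduct (allFin n) (allFin n)))))) z≤n
    }

  include : ∀ I → Irreducible I → ∀ b → IsBranchingVertex I b → Instance
  include I irr b (b∈V , b∉S , _) = record
    { V = V I ; S = S I ∪ ⁅ b ⁆
    ; S⊆V = λ x∈ → S∪b⊆V (x∈p∪q⁻ (S I) ⁅ b ⁆ x∈)
    ; defective = ℕ.≮⇒≥ λ k< → proj₁ (irr b) (b∈V , b∉S , k<)
    }
    where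
    S∪b⊆V : ∀ {x} → x ∈ S I ⊎ x ∈ ⁅ b ⁆ → x ∈ V I
    S∪b⊆V (inj₁ x∈S) = S⊆V I x∈S
    S∪b⊆V (inj₂ x∈b) = subst (_∈ V I) (sym (x∈⁅y⁆⇒x≡y b x∈b)) b∈V

  exclude : ∀ I b → IsBranchingVertex I b → Instance
  exclude I b (_ , b∉S , _) = record
    { V = V I - b ; S = S I
    ; S⊆V = λ x∈S → x∈p∧x≢y⇒x∈p-y (S⊆V I x∈S) λ { refl → b∉S x∈S }
    ; defective = defective I
    }

  size : Instance → ℕ
  size I = ∣ V I ─ S I ∣

  x∈p─q⇒x∉q : ∀ {m} {x : Fin m} (p q : Subset m) → x ∈ p ─ q → x ∉ q
  x∈p─q⇒x∉q (_ ∷ p) (outside ∷ q) (there x∈) (there x∈q) = x∈p─q⇒x∉q p q x∈ x∈q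
  x∈p─q⇒x∉q (_ ∷ p) (inside  ∷ q) (there x∈) (there x∈q) = x∈p─q⇒x∉q p q x∈ x∈q

  ─-mono : ∀ (p p′ q q′ : Subset n) → p′ ⊆ p → q ⊆ q′ → p′ ─ q′ ⊆ p ─ q
  ─-mono p p′ q q′ p′⊆p q⊆q′ x∈ =
    x∈p∧x∉q⇒x∈p─q (p′⊆p (p─q⊆p p′ q′ x∈))
                  (λ x∈q → x∈p─q⇒x∉q p′ q′ x∈ (q⊆q′ x∈q))

  ⟶-size : ∀ {I J} → I ⟶ J → size J ≤ size I
  ⟶-size {I} (rr1 u _ refl refl) =
    p⊆q⇒∣p∣≤∣q∣ (─-mono (V I) (V I - u) (S I) (S I) (p─q⊆p (V I) ⁅ u ⁆) (λ x∈ → x∈))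
  ⟶-size {I} (rr2 u _ refl refl) =
    p⊆q⇒∣p∣≤∣q∣ (─-mono (V I) (V I) (S I) (S I ∪ ⁅ u ⁆) (λ x∈ → x∈) (p⊆p∪q ⁅ u ⁆))

  ⟶*-size : ∀ {I J} → I ⟶* J → size J ≤ size I
  ⟶*-size Star.ε       = ℕ.≤-refl
  ⟶*-size (I⟶K ◅ K⟶*J) = ℕ.≤-trans (⟶*-size K⟶*J) (⟶-size I⟶K)

  include-size : ∀ I irr b br → size (include I irr b br) < size I
  include-size I irr b (b∈V , b∉S , _) = p⊂q⇒∣p∣<∣q∣
    ( ─-mono (V I) (V I) (S I) (S I ∪ ⁅ b ⁆) (λ x∈ → x∈) (p⊆p∪q ⁅ b ⁆)
    , b , x∈p∧x∉q⇒x∈p─q b∈V b∉S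
    , λ b∈ → x∈p─q⇒x∉q (V I) (S I ∪ ⁅ b ⁆) b∈ (q⊆p∪q (S I) ⁅ b ⁆ (x∈⁅x⁆ b)))

  exclude-size : ∀ I b br → size (exclude I b br) < size I
  exclude-size I b (b∈V , b∉S , _) = p⊂q⇒∣p∣<∣q∣
    ( ─-mono (V I) (V I - b) (S I) (S I) (p─q⊆p (V I) ⁅ b ⁆) (λ x∈ → x∈)
    , b , x∈p∧x∉q⇒x∈p─q b∈V b∉S
    , λ b∈ → x∈p─q⇒x∉q (V I) ⁅ b ⁆ (p─q⊆p (V I - b) (S I) b∈) (x∈⁅x⁆ b))

  update : Subset n → Subset n → Subset n
  update C* W with ∣ W ∣ ≤? ∣ C* ∣
  ... | yes _ = C*
  ... | no  _ = W

  module _ (A : Implementation) where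
    open Implementation A

    -- Returns the final value of C* and the running time; issuing a call of BB
    -- takes one unit of time.
    BB : (I : Instance) → Subset n → Acc _<_ (size I) → Subset n × ℕ
    BB I C* (acc rs) with isDefectiveClique? G k (V (reduce I))
    ... | yes _   = update C* (V (reduce I)) , cost I C*
    ... | no ¬def =
      let J         = reduce I
          irr       = irreducible I
          b         = branch J irr ¬def
          br        = branching J irr ¬def
          J≤I       = ⟶*-size (reduces I)
          (C₁ , t₁) = BB (include J irr b br) C*
                        (rs (ℕ.<-≤-trans (include-size J irr b br) J≤I))
          (C₂ , t₂) = BB (exclude J b br) C₁
                        (rs (ℕ.<-≤-trans (exclude-size J b br) J≤I))
      in C₂ , cost I C* + suc t₁ + suc t₂

    kDC-t : Subset n × ℕ
    kDC-t =
      let (C* , t) = BB initial ⊥ (<-wellFounded (size initial))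
      in C* , suc t

    running-time : ℕ
    running-time = proj₂ kDC-t

infix 4 _∈𝒪_ _∈𝒪*_

_∈𝒪_ : (∀ {n} → Graph n → ℕ) → (ℕ → ℝ) → Set
T ∈𝒪 f = Σ[ C ∈ ℕ ] Σ[ n₀ ∈ ℕ ]
  (∀ {n} → n₀ ≤ n → (G : Graph n) → fromℕᴿ (T G) ≤ᴿ fromℕᴿ C *ᴿ f n)

PolynomiallyBounded : (ℕ → ℕ) → Set
PolynomiallyBounded P = Σ[ c ∈ ℕ ] Σ[ d ∈ ℕ ] (∀ n → P n ≤ c * n ^ d + c)

_∈𝒪*_ : (∀ {n} → Graph n → ℕ) → (ℕ → ℝ) → Set
T ∈𝒪* f = Σ[ q ∈ (ℕ → ℕ) ]
  PolynomiallyBounded q × (T ∈𝒪 λ n → fromℕᴿ (q n) *ᴿ f n)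

{-# OPTIONS --safe #-}
-- Say that an instance (g , S) has level l if S has at least l non-edges, or if
-- S has at least l - 1 non-edges and some vertex outside S has a non-neighbour
-- in S.  At a reduced instance the branching vertex has two non-neighbours in g,
-- by RR2, so adding it to S raises the level; and an instance of level k + 1 is
-- never reduced, by RR1.  Hence k + 1 consecutive left branches, together with the
-- reduction that follows, shrink V(g) \ S by at least k + 2 vertices, whence
-- T(m) ≤ T(m - 1) + ⋯ + T(m - k - 2).
module Submission where

open import Defs
open import Algebra.Bundles using (CommutativeRing)
open import Data.Bool using (true; false)
import Data.Bool.Properties as Bool
open import Data.Fin using (Fin)
import Data.Fin as Fin
import Data.Fin.Properties as Fin
open import Data.Fin.Subset
open import Data.Fin.Subset.Properties
open import Data.Integer using (+_; -[1+_]; +≤+; -≤+)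
import Data.Integer as ℤ
import Data.Integer.Properties as ℤ
open import Data.List using (List; []; _∷_; _++_; length; map; cartesianProduct; allFin)
import Data.List.Properties as List
open import Data.List.Membership.Propositional using () renaming (_∈_ to _∈ˡ_)
import Data.List.Membership.Propositional.Properties as ∈
open import Data.List.Relation.Binary.Subset.Propositional using () renaming (_⊆_ to _⊆ˡ_)
open import Data.List.Relation.Unary.All as All using (All; []; _∷_)
open import Data.List.Relation.Unary.AllPairs using ([]; _∷_)
open import Data.List.Relation.Unary.Any using (here; there)
open import Data.List.Relation.Unary.Unique.Propositional using (Unique)
import Data.List.Relation.Unary.Unique.Propositional.Properties as Unique
open import Data.Nat using (ℕ; zero; suc; _+_; _*_; _⊔_; _≤_; _<_; z≤n; s≤s)
import Data.Nat as ℕ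
import Data.Nat.Coprimality as Coprimality
open import Data.Nat.Induction using (Acc; acc; <-wellFounded)
import Data.Nat.Properties as ℕ
open import Data.Nat.Solver using () renaming (module +-*-Solver to ℕ-Solver)
open import Data.Product using (Σ-syntax; ∃-syntax; _×_; _,_; proj₁; proj₂)
open import Data.Rational as ℚ using (ℚ; 0ℚ; 1ℚ; ½; mkℚ; *≤*)
import Data.Rational.Properties as ℚ
open import Data.Rational.Solver using (module +-*-Solver)
open import Data.Sum using (_⊎_; inj₁; inj₂)
open import Data.Vec using (tabulate; []; _∷_)
import Data.Vec.Properties as Vec
open import Function using (_∘_)
open import Relation.Binary.Construct.Closure.ReflexiveTransitive as Star using (_◅_)
open import Relation.Binary.Definitions using (tri<; tri≈; tri>)
open import Relation.Binary.PropositionalEquality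
  using (_≡_; _≢_; refl; sym; trans; cong; cong₂; subst; subst₂; module ≡-Reasoning)
open import Relation.Nullary using (¬_; Dec; yes; no; ¬?; contradiction)
open import Relation.Nullary.Decidable using (_×-dec_; toWitness; toWitnessFalse)

open import Algebra.Properties.CommutativeSemiring.Exp
  (CommutativeRing.commutativeSemiring ℚ.+-*-commutativeRing)
  using (_^_; ^-distrib-*)

-- The recurrence is never evaluated at γ itself. A real is a Cauchy sequence here, and no term of γ
-- need satisfy the root inequality exactly, whereas the induction over the branching needs it
-- exactly. So the induction is run for an arbitrary rational `x` between 1 and 4 with
-- `geom x (2 + k) ≤ x ^ (2 + k)`, and γ enters only afterwards, through slightly enlarged terms of
-- its sequence. Multiplying that inequality by `x - 1` produces the given polynomial, hence its
-- extra root 1; a root constructed in [3/2, 2] lets the maximality of γ keep its terms away from 1.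
-- A reduction may destroy a level, since RR1 can delete the exposed vertex. This is harmless: a
-- reduction that changes anything decreases `size`, which pays for one term of the sum, and the
-- chain of left branches restarts at level 0.

-- Counting in lists and subsets.

unique-⊆⇒length≤ : ∀ {a} {X : Set a} {xs ys : List X} →
  Unique xs → xs ⊆ˡ ys → length xs ≤ length ys
unique-⊆⇒length≤ {xs = []} [] xs⊆ys = z≤n
unique-⊆⇒length≤ {X = X} {xs = x ∷ xs} (x∉xs ∷ uniq) xs⊆ys with ∈.∈-∃++ (xs⊆ys (here refl))
... | as , bs , refl = begin
    suc (length xs)             ≤⟨ s≤s (unique-⊆⇒length≤ uniq xs⊆as++bs) ⟩
    suc (length (as ++ bs))     ≡⟨ cong suc (List.length-++ as) ⟩
    suc (length as + length bs) ≡⟨ ℕ.+-suc (length as) (length bs) ⟨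
    length as + suc (length bs) ≡⟨ List.length-++ as ⟨
    length (as ++ x ∷ bs)       ∎
  where
  open ℕ.≤-Reasoning
  xs⊆as++bs : xs ⊆ˡ as ++ bs
  xs⊆as++bs y∈xs with ∈.∈-++⁻ as (xs⊆ys (there y∈xs))
  ... | inj₁ y∈as         = ∈.∈-++⁺ˡ y∈as
  ... | inj₂ (here refl)  = contradiction refl (All.lookup x∉xs y∈xs)
  ... | inj₂ (there y∈bs) = ∈.∈-++⁺ʳ as y∈bs

∣p∪q∣≤∣p∣+∣q∣ : ∀ {n} (p q : Subset n) → ∣ p ∪ q ∣ ≤ ∣ p ∣ + ∣ q ∣
∣p∪q∣≤∣p∣+∣q∣ []            []            = z≤n
∣p∪q∣≤∣p∣+∣q∣ (outside ∷ p) (outside ∷ q) = ∣p∪q∣≤∣p∣+∣q∣ p q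
∣p∪q∣≤∣p∣+∣q∣ (outside ∷ p) (inside  ∷ q) =
  ℕ.≤-trans (s≤s (∣p∪q∣≤∣p∣+∣q∣ p q)) (ℕ.≤-reflexive (sym (ℕ.+-suc ∣ p ∣ ∣ q ∣)))
∣p∪q∣≤∣p∣+∣q∣ (inside  ∷ p) (q ∷ qs)      =
  s≤s (ℕ.≤-trans (∣p∪q∣≤∣p∣+∣q∣ p qs) (ℕ.+-monoʳ-≤ ∣ p ∣ (∣p∣≤∣x∷p∣ q qs)))

-- The form in which `nonEdges` lists an unordered pair.
sortedPair : ∀ {n} → Fin n → Fin n → Fin n × Fin n
sortedPair u v with u Fin.<? v
... | yes _ = u , v
... | no  _ = v , u

sortedPair-injective : ∀ {n} (u : Fin n) {v w} → sortedPair u v ≡ sortedPair u w → v ≡ w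
sortedPair-injective u {v} {w} eq with u Fin.<? v | u Fin.<? w
... | yes _ | yes _ = cong proj₂ eq
... | yes _ | no  _ = trans (cong proj₂ eq) (cong proj₁ eq)
... | no  _ | yes _ = trans (cong proj₁ eq) (cong proj₂ eq)
... | no  _ | no  _ = cong proj₁ eq

-- Non-edges gained by adding a vertex, and non-neighbours from a degree bound.

module _ {n : ℕ} (G : Graph n) where
  open Graph G

  nonEdges-unique : ∀ S → Unique (nonEdges G S)
  nonEdges-unique S = Unique.filter⁺ (isNonEdgeIn? G S)
    (Unique.cartesianProduct⁺ (Unique.allFin⁺ n) (Unique.allFin⁺ n))

  ∈-nonEdges⁺ : ∀ {S e} → IsNonEdgeIn G S e → e ∈ˡ nonEdges G S
  ∈-nonEdges⁺ {S} {u , v} = ∈.∈-filter⁺ (isNonEdgeIn? G S)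
    (∈.∈-cartesianProduct⁺ (∈.∈-allFin u) (∈.∈-allFin v))

  ∈-nonEdges⁻ : ∀ {S e} → e ∈ˡ nonEdges G S → IsNonEdgeIn G S e
  ∈-nonEdges⁻ {S} = proj₂ ∘
    ∈.∈-filter⁻ (isNonEdgeIn? G S) {xs = cartesianProduct (allFin n) (allFin n)}

  sortedPair-isNonEdge : ∀ {S u v} → u ∈ S → v ∈ S → v ≢ u → adj u v ≡ false →
    IsNonEdgeIn G S (sortedPair u v)
  sortedPair-isNonEdge {u = u} {v} u∈ v∈ v≢u uv with u Fin.<? v
  ... | yes u<v = u<v , u∈ , v∈ , uv
  ... | no  u≮v with Fin.<-cmp u v
  ...   | tri< u<v _ _ = contradiction u<v u≮v
  ...   | tri≈ _ u≡v _ = contradiction (sym u≡v) v≢u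
  ...   | tri> _ _ v<u = v<u , v∈ , u∈ , trans (symmetric v u) uv

  IsNonNeighborIn : Subset n → Fin n → Fin n → Set
  IsNonNeighborIn S u v = v ∈ S × v ≢ u × adj u v ≡ false

  -- The pairs of `u` with the `vs` are distinct non-edges of the enlarged set, and none of them
  -- lies in `S` because `u` does not.
  ∣Ē∣-∪ : ∀ S {u} (vs : List (Fin n)) → u ∉ S → Unique vs → All (IsNonNeighborIn S u) vs →
    ∣Ē_∣ G S + length vs ≤ ∣Ē_∣ G (S ∪ ⁅ u ⁆)
  ∣Ē∣-∪ S {u} vs u∉S uniq nonNbrs = begin
    ∣Ē_∣ G S + length vs
      ≡⟨ cong (λ l → ∣Ē_∣ G S + l) (List.length-map (sortedPair u) vs) ⟨
    ∣Ē_∣ G S + length (map (sortedPair u) vs)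
      ≡⟨ List.length-++ (nonEdges G S) ⟨
    length (nonEdges G S ++ map (sortedPair u) vs)
      ≤⟨ unique-⊆⇒length≤
           (Unique.++⁺ (nonEdges-unique S) (Unique.map⁺ (sortedPair-injective u) uniq) disjoint)
           includes ⟩
    ∣Ē_∣ G (S ∪ ⁅ u ⁆) ∎
    where
    open ℕ.≤-Reasoning
    u∉nonEdge : ∀ {v} → ¬ IsNonEdgeIn G S (sortedPair u v)
    u∉nonEdge {v} ne with u Fin.<? v
    u∉nonEdge (_ , u∈S , _ , _) | yes _ = u∉S u∈S
    u∉nonEdge (_ , _ , u∈S , _) | no  _ = u∉S u∈S

    disjoint : ∀ {e} → ¬ (e ∈ˡ nonEdges G S × e ∈ˡ map (sortedPair u) vs)
    disjoint (e∈ , e∈map) with ∈.∈-map⁻ (sortedPair u) e∈map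
    ... | v , _ , refl = u∉nonEdge {v} (∈-nonEdges⁻ e∈)

    includes : nonEdges G S ++ map (sortedPair u) vs ⊆ˡ nonEdges G (S ∪ ⁅ u ⁆)
    includes e∈ with ∈.∈-++⁻ (nonEdges G S) e∈
    ... | inj₁ e∈S =
      let x<y , x∈ , y∈ , xy = ∈-nonEdges⁻ e∈S
      in ∈-nonEdges⁺ (x<y , p⊆p∪q ⁅ u ⁆ x∈ , p⊆p∪q ⁅ u ⁆ y∈ , xy)
    ... | inj₂ e∈map with ∈.∈-map⁻ (sortedPair u) e∈map
    ...   | v , v∈vs , refl =
      let v∈ , v≢u , uv = All.lookup nonNbrs v∈vs
      in ∈-nonEdges⁺ (sortedPair-isNonEdge (q⊆p∪q S ⁅ u ⁆ (x∈⁅x⁆ u)) (p⊆p∪q ⁅ u ⁆ v∈) v≢u uv)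

  -- Otherwise `V` is covered by `w`, `u` and the neighbours of `u`. The forbidden vertex `w` is
  -- there so that two uses yield two distinct non-neighbours.
  another-nonNeighbor : ∀ {V u} w → 2 + degreeIn G V u < ∣ V ∣ →
    ∃[ v ] v ≢ w × IsNonNeighborIn V u v
  another-nonNeighbor {V} {u} w deg<
    with Fin.any? (λ v → ¬? (v Fin.≟ w) ×-dec (v ∈? V) ×-dec ¬? (v Fin.≟ u) ×-dec (adj u v Bool.≟ false))
  ... | yes found = found
  ... | no  none  = contradiction deg< (ℕ.≤⇒≯ (begin
      ∣ V ∣                                ≤⟨ p⊆q⇒∣p∣≤∣q∣ V⊆ ⟩
      ∣ (⁅ w ⁆ ∪ ⁅ u ⁆) ∪ N ∣              ≤⟨ ∣p∪q∣≤∣p∣+∣q∣ (⁅ w ⁆ ∪ ⁅ u ⁆) N ⟩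
      ∣ ⁅ w ⁆ ∪ ⁅ u ⁆ ∣ + ∣ N ∣            ≤⟨ ℕ.+-monoˡ-≤ ∣ N ∣ (∣p∪q∣≤∣p∣+∣q∣ ⁅ w ⁆ ⁅ u ⁆) ⟩
      ∣ ⁅ w ⁆ ∣ + ∣ ⁅ u ⁆ ∣ + ∣ N ∣        ≡⟨ cong (_+ ∣ N ∣) (cong₂ _+_ (∣⁅x⁆∣≡1 w) (∣⁅x⁆∣≡1 u)) ⟩
      2 + ∣ N ∣                            ∎))
    where
    open ℕ.≤-Reasoning
    N = V ∩ tabulate (adj u)
    V⊆ : V ⊆ (⁅ w ⁆ ∪ ⁅ u ⁆) ∪ N
    V⊆ {v} v∈ with v Fin.≟ w | v Fin.≟ u | adj u v in uv
    ... | yes refl | _        | _     = p⊆p∪q N (p⊆p∪q ⁅ u ⁆ (x∈⁅x⁆ w))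
    ... | no _     | yes refl | _     = p⊆p∪q N (q⊆p∪q ⁅ w ⁆ ⁅ u ⁆ (x∈⁅x⁆ u))
    ... | no v≢w   | no v≢u   | false = contradiction (v , v≢w , v∈ , v≢u , uv) none
    ... | no _     | no _     | true  = q⊆p∪q (⁅ w ⁆ ∪ ⁅ u ⁆) N
      (x∈p∩q⁺ (v∈ , Vec.lookup⇒[]= v (tabulate (adj u)) (trans (Vec.lookup∘tabulate (adj u) v) uv)))

-- Levels of instances and their growth along left branches.

module _ (k : ℕ) {n : ℕ} (G : Graph n) where
  open Graph G
  open Instance

  Exposed : Instance k G → Set
  Exposed I = ∃[ u ] u ∈ V I × u ∉ S I × HasNonNeighborIn G (S I) u

  Level : ℕ → Instance k G → Set
  Level l I = l ≤ ∣Ē_∣ G (S I) ⊎ (l ≤ suc (∣Ē_∣ G (S I)) × Exposed I)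

  exposing-branch : ∀ {I b} → IsBranchingVertex k G I b → Exposed I → HasNonNeighborIn G (S I) b
  exposing-branch (_ , _ , inj₁ h)    _                  = h
  exposing-branch (_ , _ , inj₂ none) (u , u∈V , u∉S , h) = contradiction h (none u u∈V u∉S)

  -- Inapplicability of RR1 supplies the first condition of RR2, so RR2 can only fail on the degree.
  degree-bound : ∀ {I u} → Irreducible k G I → u ∈ V I → u ∉ S I → 2 + degreeIn G (V I) u < ∣ V I ∣
  degree-bound {I} {u} irr u∈V u∉S with 2 + degreeIn G (V I) u ℕ.<? ∣ V I ∣
  ... | yes deg< = deg<
  ... | no  deg≮ = contradiction
    (u∈V , u∉S , ℕ.≮⇒≥ (λ k< → proj₁ (irr u) (u∈V , u∉S , k<))
               , ℕ.m≤n+o⇒m∸n≤o _ 2 (ℕ.≮⇒≥ deg≮))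
    (proj₂ (irr u))

  -- Two non-neighbours of `b` in the graph decide the form of the new level. If one is outside S,
  -- it becomes exposed to `b`, and `b` itself adds a non-edge whenever the old level relied on an
  -- exposed vertex. If both are in S, two non-edges appear at once, which makes up for a possible
  -- deficit of one.
  include-level : ∀ {l} I irr b br → Level l I → Level (suc l) (include k G I irr b br)
  include-level {l} I irr b br@(b∈V , b∉S , _) level
    -- Forbidding `b` is a dummy choice: a non-neighbour of `b` differs from `b` anyway.
    with another-nonNeighbor G b (degree-bound {I} irr b∈V b∉S)
  ... | v , _ , v-nn with another-nonNeighbor G v (degree-bound {I} irr b∈V b∉S)
  ...   | w , w≢v , w-nn = go (v ∈? S I) (w ∈? S I)
    where
    J = include k G I irr b br

    grow : ∀ vs → Unique vs → All (IsNonNeighborIn G (S I) b) vs →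
      length vs + ∣Ē_∣ G (S I) ≤ ∣Ē_∣ G (S J)
    grow vs uniq nn = ℕ.≤-trans (ℕ.≤-reflexive (ℕ.+-comm (length vs) _)) (∣Ē∣-∪ G (S I) vs b∉S uniq nn)

    l≤Ē-J : Level l I → l ≤ ∣Ē_∣ G (S J)
    l≤Ē-J (inj₁ l≤Ē) = ℕ.≤-trans l≤Ē (grow [] [] [])
    l≤Ē-J (inj₂ (l≤ , exposed)) with exposing-branch {I} br exposed
    ... | x , x-nn = ℕ.≤-trans l≤ (grow (x ∷ []) ([] ∷ []) (x-nn ∷ []))

    l≤1+Ē : Level l I → l ≤ suc (∣Ē_∣ G (S I))
    l≤1+Ē (inj₁ l≤Ē)      = ℕ.m≤n⇒m≤1+n l≤Ē
    l≤1+Ē (inj₂ (l≤ , _)) = l≤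

    expose : ∀ {u} → IsNonNeighborIn G (V I) b u → u ∉ S I → Level (suc l) J
    expose {u} (u∈V , u≢b , bu) u∉S =
      inj₂ (s≤s (l≤Ē-J level) , u , u∈V , u∉S∪b , b , q⊆p∪q (S I) ⁅ b ⁆ (x∈⁅x⁆ b) , u≢b ∘ sym
           , trans (symmetric u b) bu)
      where
      u∉S∪b : u ∉ S I ∪ ⁅ b ⁆
      u∉S∪b u∈ with x∈p∪q⁻ (S I) ⁅ b ⁆ u∈
      ... | inj₁ u∈S = u∉S u∈S
      ... | inj₂ u∈b = u≢b (x∈⁅y⁆⇒x≡y b u∈b)

    go : Dec (v ∈ S I) → Dec (w ∈ S I) → Level (suc l) J
    go (no v∉S) _         = expose v-nn v∉S
    go (yes _) (no w∉S)   = expose w-nn w∉S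
    go (yes v∈S) (yes w∈S) = inj₁ (ℕ.≤-trans (s≤s (l≤1+Ē level))
      (grow (v ∷ w ∷ []) (((w≢v ∘ sym) ∷ []) ∷ [] ∷ []) ((v∈S , proj₂ v-nn) ∷ (w∈S , proj₂ w-nn) ∷ [])))

  -- The first form contradicts defectiveness of S; in the second, adding the exposed vertex would
  -- exceed `k`, so RR1 applies to it.
  irreducible⇒¬level : ∀ {I} → Irreducible k G I → ¬ Level (suc k) I
  irreducible⇒¬level {I} irr (inj₁ k<) = ℕ.<⇒≱ k< (defective I)
  irreducible⇒¬level {I} irr (inj₂ (s≤s k≤ , u , u∈V , u∉S , v , v-nn)) =
    proj₁ (irr u) (u∈V , u∉S , (begin-strict
      k                       ≤⟨ k≤ ⟩
      ∣Ē_∣ G (S I)            <⟨ ℕ.n<1+n _ ⟩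
      1 + ∣Ē_∣ G (S I)        ≡⟨ ℕ.+-comm 1 _ ⟩
      ∣Ē_∣ G (S I) + 1        ≤⟨ ∣Ē∣-∪ G (S I) (v ∷ []) u∉S ([] ∷ []) (v-nn ∷ []) ⟩
      ∣Ē_∣ G (S I ∪ ⁅ u ⁆)    ∎))
    where open ℕ.≤-Reasoning

  ⟶-size-< : ∀ {I J} → _⟶_ k G I J → size k G J < size k G I
  ⟶-size-< {I} (rr1 u (u∈V , u∉S , _) refl refl) = p⊂q⇒∣p∣<∣q∣
    ( ─-mono k G (V I) (V I - u) (S I) (S I) (p─q⊆p (V I) ⁅ u ⁆) (λ x∈ → x∈)
    , u , x∈p∧x∉q⇒x∈p─q u∈V u∉S
    , λ u∈ → x∈p─q⇒x∉q k G (V I) ⁅ u ⁆ (p─q⊆p (V I - u) (S I) u∈) (x∈⁅x⁆ u))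
  ⟶-size-< {I} (rr2 u (u∈V , u∉S , _) refl refl) = p⊂q⇒∣p∣<∣q∣
    ( ─-mono k G (V I) (V I) (S I) (S I ∪ ⁅ u ⁆) (λ x∈ → x∈) (p⊆p∪q ⁅ u ⁆)
    , u , x∈p∧x∉q⇒x∈p─q u∈V u∉S
    , λ u∈ → x∈p─q⇒x∉q k G (V I) (S I ∪ ⁅ u ⁆) u∈ (q⊆p∪q (S I) ⁅ u ⁆ (x∈⁅x⁆ u)))

  -- Either the instance was already reduced and its level survives, or a smaller size compensates
  -- for losing the level.
  ⟶*-≡⊎size-< : ∀ {I J} → _⟶*_ k G I J → J ≡ I ⊎ size k G J < size k G I
  ⟶*-≡⊎size-< Star.ε       = inj₁ refl
  ⟶*-≡⊎size-< (I⟶K ◅ K⟶*J) = inj₂ (ℕ.≤-<-trans (⟶*-size k G K⟶*J) (⟶-size-< I⟶K))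

-- Rational arithmetic, powers and geometric sums.

fromℕ : ℕ → ℚ
fromℕ m = + m ℚ./ 1

-- The division in `fromℕ` normalises through a gcd that is stuck on a variable; the explicit
-- fraction lets sums, products and order compute.
fromℕ-mkℚ : ∀ m → fromℕ m ≡ mkℚ (+ m) 0 (Coprimality.sym (Coprimality.1-coprimeTo m))
fromℕ-mkℚ m = ℚ.normalize-coprime (Coprimality.sym (Coprimality.1-coprimeTo m))

fromℕ-+ : ∀ m n → fromℕ (m + n) ≡ fromℕ m ℚ.+ fromℕ n
fromℕ-+ m n = trans
  (cong (ℚ._/ 1) (sym (cong₂ ℤ._+_ (ℤ.*-identityʳ (+ m)) (ℤ.*-identityʳ (+ n)))))
  (sym (cong₂ ℚ._+_ (fromℕ-mkℚ m) (fromℕ-mkℚ n)))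

fromℕ-* : ∀ m n → fromℕ (m * n) ≡ fromℕ m ℚ.* fromℕ n
fromℕ-* m n = trans
  (cong (ℚ._/ 1) (ℤ.pos-* m n))
  (sym (cong₂ ℚ._*_ (fromℕ-mkℚ m) (fromℕ-mkℚ n)))

fromℕ-mono-≤ : ∀ {m n} → m ≤ n → fromℕ m ℚ.≤ fromℕ n
fromℕ-mono-≤ {m} {n} m≤n = subst₂ ℚ._≤_ (sym (fromℕ-mkℚ m)) (sym (fromℕ-mkℚ n))
  (*≤* (ℤ.*-monoʳ-≤-nonNeg (+ 1) (+≤+ m≤n)))

0≤fromℕ : ∀ m → 0ℚ ℚ.≤ fromℕ m
0≤fromℕ m = fromℕ-mono-≤ {0} {m} z≤n

*-monoˡ-≤ : ∀ {p q r} → 0ℚ ℚ.≤ r → p ℚ.≤ q → r ℚ.* p ℚ.≤ r ℚ.* q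
*-monoˡ-≤ {r = r} 0≤r = ℚ.*-monoˡ-≤-nonNeg r {{ℚ.nonNegative 0≤r}}

*-monoʳ-≤ : ∀ {p q r} → 0ℚ ℚ.≤ r → p ℚ.≤ q → p ℚ.* r ℚ.≤ q ℚ.* r
*-monoʳ-≤ {r = r} 0≤r = ℚ.*-monoʳ-≤-nonNeg r {{ℚ.nonNegative 0≤r}}

*-mono-≤ : ∀ {p q r s} → 0ℚ ℚ.≤ q → 0ℚ ℚ.≤ r → p ℚ.≤ q → r ℚ.≤ s → p ℚ.* r ℚ.≤ q ℚ.* s
*-mono-≤ 0≤q 0≤r p≤q r≤s = ℚ.≤-trans (*-monoʳ-≤ 0≤r p≤q) (*-monoˡ-≤ 0≤q r≤s)

*-nonNeg : ∀ {p q} → 0ℚ ℚ.≤ p → 0ℚ ℚ.≤ q → 0ℚ ℚ.≤ p ℚ.* q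
*-nonNeg {p} {q} 0≤p 0≤q = subst (ℚ._≤ p ℚ.* q) (ℚ.*-zeroʳ p) (*-monoˡ-≤ 0≤p 0≤q)

p≤p+q : ∀ {p q} → 0ℚ ℚ.≤ q → p ℚ.≤ p ℚ.+ q
p≤p+q {p} {q} 0≤q = subst (ℚ._≤ p ℚ.+ q) (ℚ.+-identityʳ p) (ℚ.+-monoʳ-≤ p 0≤q)

p≤q+p : ∀ {p q} → 0ℚ ℚ.≤ q → p ℚ.≤ q ℚ.+ p
p≤q+p {p} {q} 0≤q = subst (ℚ._≤ q ℚ.+ p) (ℚ.+-identityˡ p) (ℚ.+-monoˡ-≤ p 0≤q)

0≤1 : 0ℚ ℚ.≤ 1ℚ
0≤1 = ℚ.nonNegative⁻¹ 1ℚ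

^-nonNeg : ∀ {x} n → 0ℚ ℚ.≤ x → 0ℚ ℚ.≤ x ^ n
^-nonNeg zero    0≤x = 0≤1
^-nonNeg (suc n) 0≤x = *-nonNeg 0≤x (^-nonNeg n 0≤x)

^-monoˡ-≤ : ∀ {x y} n → 0ℚ ℚ.≤ x → x ℚ.≤ y → x ^ n ℚ.≤ y ^ n
^-monoˡ-≤ zero    0≤x x≤y = ℚ.≤-refl
^-monoˡ-≤ (suc n) 0≤x x≤y = *-mono-≤ (ℚ.≤-trans 0≤x x≤y) (^-nonNeg n 0≤x) x≤y (^-monoˡ-≤ n 0≤x x≤y)

1≤x^n : ∀ {x} n → 1ℚ ℚ.≤ x → 1ℚ ℚ.≤ x ^ n
1≤x^n zero    1≤x = ℚ.≤-refl
1≤x^n (suc n) 1≤x = *-mono-≤ (ℚ.≤-trans 0≤1 1≤x) 0≤1 1≤x (1≤x^n n 1≤x)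

^-monoʳ-≤ : ∀ {x m n} → 1ℚ ℚ.≤ x → m ≤ n → x ^ m ℚ.≤ x ^ n
^-monoʳ-≤ {n = n} 1≤x z≤n       = 1≤x^n n 1≤x
^-monoʳ-≤         1≤x (s≤s m≤n) = *-monoˡ-≤ (ℚ.≤-trans 0≤1 1≤x) (^-monoʳ-≤ 1≤x m≤n)

geom : ℚ → ℕ → ℚ
geom x zero    = 0ℚ
geom x (suc j) = geom x j ℚ.+ x ^ j

geom-nonNeg : ∀ {x} j → 0ℚ ℚ.≤ x → 0ℚ ℚ.≤ geom x j
geom-nonNeg zero    0≤x = ℚ.≤-refl
geom-nonNeg (suc j) 0≤x = ℚ.+-mono-≤ (geom-nonNeg j 0≤x) (^-nonNeg j 0≤x)

-- Solving the recurrence at a rational base.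

module Weights (x : ℚ) (1≤x : 1ℚ ℚ.≤ x) (x≤4 : x ℚ.≤ fromℕ 4) (M : ℚ) (0≤M : 0ℚ ℚ.≤ M) where
  open ℚ.≤-Reasoning
  open +-*-Solver

  0≤x : 0ℚ ℚ.≤ x
  0≤x = ℚ.≤-trans 0≤1 1≤x

  K : ℚ
  K = M ℚ.* fromℕ 4

  0≤K : 0ℚ ℚ.≤ K
  0≤K = *-nonNeg 0≤M (0≤fromℕ 4)

  -- τ ≤ K xˢ (x⁻¹ + ⋯ + x⁻ʲ), cleared of denominators.
  record Bounded (j s : ℕ) (τ : ℚ) : Set where
    constructor weighted
    field weighted-≤ : τ ℚ.* x ^ j ℚ.≤ K ℚ.* (x ^ s ℚ.* geom x j)

  -- Only the top term `x ^ j` of the sum is used. It is one factor `x` short, and `x ≤ 4` pays for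
  -- that; hence the 4 in `K`.
  leaf-bounded : ∀ j s {τ} → τ ℚ.≤ M → Bounded (suc j) s τ
  leaf-bounded j s {τ} τ≤M = weighted (begin
    τ ℚ.* (x ℚ.* x ^ j)
      ≤⟨ *-mono-≤ 0≤M (^-nonNeg (suc j) 0≤x) τ≤M (*-monoʳ-≤ (^-nonNeg j 0≤x) x≤4) ⟩
    M ℚ.* (fromℕ 4 ℚ.* x ^ j)
      ≡⟨ ℚ.*-assoc M (fromℕ 4) (x ^ j) ⟨
    K ℚ.* x ^ j
      ≡⟨ cong (K ℚ.*_) (ℚ.*-identityˡ (x ^ j)) ⟨
    K ℚ.* (1ℚ ℚ.* x ^ j)
      ≤⟨ *-monoˡ-≤ 0≤K (*-mono-≤ (^-nonNeg s 0≤x) (^-nonNeg j 0≤x)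
           (1≤x^n s 1≤x) (p≤q+p (geom-nonNeg j 0≤x))) ⟩
    K ℚ.* (x ^ s ℚ.* geom x (suc j)) ∎)

  -- The loss of one unit of size shifts the left child's terms to x⁻², ..., x⁻ʲ⁻¹, and the right
  -- child fills the vacant place x⁻¹.
  branch-bounded : ∀ {j s₁ s₂ s τ₁ τ₂ τ} → τ ℚ.≤ τ₁ ℚ.+ τ₂ →
    Bounded j s₁ τ₁ → τ₂ ℚ.≤ K ℚ.* x ^ s₂ → s₁ < s → s₂ < s → Bounded (suc j) s τ
  branch-bounded {j} {s₁} {s₂} {s} {τ₁} {τ₂} {τ} τ≤ (weighted τ₁≤) τ₂≤ s₁<s s₂<s = weighted (begin
    τ ℚ.* (x ℚ.* x ^ j)
      ≤⟨ *-monoʳ-≤ (^-nonNeg (suc j) 0≤x) τ≤ ⟩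
    (τ₁ ℚ.+ τ₂) ℚ.* (x ℚ.* x ^ j)
      ≡⟨ solve 4 (λ a b x p → (a :+ b) :* (x :* p) := x :* (a :* p) :+ b :* (x :* p)) refl τ₁ τ₂ x (x ^ j) ⟩
    x ℚ.* (τ₁ ℚ.* x ^ j) ℚ.+ τ₂ ℚ.* (x ℚ.* x ^ j)
      ≤⟨ ℚ.+-mono-≤ (*-monoˡ-≤ 0≤x τ₁≤) (*-monoʳ-≤ (^-nonNeg (suc j) 0≤x) τ₂≤) ⟩
    x ℚ.* (K ℚ.* (x ^ s₁ ℚ.* geom x j)) ℚ.+ (K ℚ.* x ^ s₂) ℚ.* (x ℚ.* x ^ j)
      ≡⟨ solve 6 (λ x K a g b p → x :* (K :* (a :* g)) :+ (K :* b) :* (x :* p)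
                    := K :* ((x :* a) :* g :+ (x :* b) :* p)) refl x K (x ^ s₁) (geom x j) (x ^ s₂) (x ^ j) ⟩
    K ℚ.* (x ^ suc s₁ ℚ.* geom x j ℚ.+ x ^ suc s₂ ℚ.* x ^ j)
      ≤⟨ *-monoˡ-≤ 0≤K (ℚ.+-mono-≤
           (*-monoʳ-≤ (geom-nonNeg j 0≤x) (^-monoʳ-≤ 1≤x s₁<s))
           (*-monoʳ-≤ (^-nonNeg j 0≤x) (^-monoʳ-≤ 1≤x s₂<s))) ⟩
    K ℚ.* (x ^ s ℚ.* geom x j ℚ.+ x ^ s ℚ.* x ^ j)
      ≡⟨ cong (K ℚ.*_) (ℚ.*-distribˡ-+ (x ^ s) (geom x j) (x ^ j)) ⟨
    K ℚ.* (x ^ s ℚ.* geom x (suc j)) ∎)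

  -- A branching whose left child takes no time.
  shrink-bounded : ∀ {j s₁ s τ} → τ ℚ.≤ K ℚ.* x ^ s₁ → s₁ < s → Bounded (suc j) s τ
  shrink-bounded {j} {s₁} {τ = τ} τ≤ s₁<s =
    branch-bounded (ℚ.≤-reflexive (sym (ℚ.+-identityˡ τ)))
      (weighted {j} {s₁} {0ℚ} (subst (ℚ._≤ K ℚ.* (x ^ s₁ ℚ.* geom x j)) (sym (ℚ.*-zeroˡ (x ^ j)))
        (*-nonNeg 0≤K (*-nonNeg (^-nonNeg s₁ 0≤x) (geom-nonNeg j 0≤x)))))
      τ≤ s₁<s s₁<s

  unweighted : ∀ {D s τ} → geom x D ℚ.≤ x ^ D → Bounded D s τ → τ ℚ.≤ K ℚ.* x ^ s
  unweighted {D} {s} {τ} g≤ (weighted τ≤) = ℚ.*-cancelʳ-≤-pos (x ^ D)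
    {{ℚ.positive (ℚ.<-≤-trans (ℚ.positive⁻¹ 1ℚ) (1≤x^n D 1≤x))}} (begin
      τ ℚ.* x ^ D                  ≤⟨ τ≤ ⟩
      K ℚ.* (x ^ s ℚ.* geom x D)   ≤⟨ *-monoˡ-≤ 0≤K (*-monoˡ-≤ (^-nonNeg s 0≤x) g≤) ⟩
      K ℚ.* (x ^ s ℚ.* x ^ D)      ≡⟨ ℚ.*-assoc K (x ^ s) (x ^ D) ⟨
      K ℚ.* x ^ s ℚ.* x ^ D        ∎)

-- The running time over the recursion tree.

module _ (k : ℕ) {n : ℕ} (G : Graph n) (A : Implementation k G) where
  open Implementation A

  time : ∀ I C* → Acc _<_ (size k G I) → ℕ
  time I C* a = proj₂ (BB k G A I C* a)

  -- The accessibility proofs and the best clique handed to the second call stay existential, since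
  -- the bounds hold for all of them.
  BB-unfold : ∀ I C* a →
    time I C* a ≡ cost I C*
    ⊎ (Σ[ b ∈ Fin n ] Σ[ br ∈ IsBranchingVertex k G (reduce I) b ]
       let I₁ = include k G (reduce I) (irreducible I) b br
           I₂ = exclude k G (reduce I) b br
       in ∃[ a₁ ] ∃[ C₁ ] ∃[ a₂ ]
          time I C* a ≡ cost I C* + suc (time I₁ C* a₁) + suc (time I₂ C₁ a₂))
  BB-unfold I C* (acc rs) with isDefectiveClique? G k (Instance.V (reduce I))
  ... | yes _ = inj₁ refl
  ... | no ¬def = inj₂
    ( branch (reduce I) (irreducible I) ¬def , branching (reduce I) (irreducible I) ¬def
    , rs _ , _ , rs _ , refl)

  module _ (P : ℕ) (cost≤P : ∀ I C* → cost I C* ≤ P)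
           (x : ℚ) (1≤x : 1ℚ ℚ.≤ x) (x≤4 : x ℚ.≤ fromℕ 4)
           (dominates : geom x (2 + k) ℚ.≤ x ^ (2 + k)) where

    -- With this offset the cost of a call is absorbed by its two subcalls:
    -- the padded time of a node is at most the sum of those of its children.
    offset : ℕ
    offset = 2 + P

    open Weights x 1≤x x≤4 (fromℕ (offset + offset)) (0≤fromℕ (offset + offset))

    padded : ∀ I C* → Acc _<_ (size k G I) → ℚ
    padded I C* a = fromℕ (time I C* a + offset)

    node-offset : ∀ c t₁ t₂ → c ≤ P →
      c + suc t₁ + suc t₂ + offset ≤ (t₁ + offset) + (t₂ + offset)
    node-offset c t₁ t₂ c≤P = begin
      c + suc t₁ + suc t₂ + offset ≡⟨ solve 4 (λ c t₁ t₂ o →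
           c :+ (con 1 :+ t₁) :+ (con 1 :+ t₂) :+ o
             := (con 2 :+ c) :+ (t₁ :+ t₂ :+ o)) refl c t₁ t₂ offset ⟩
      (2 + c) + (t₁ + t₂ + offset) ≤⟨ ℕ.+-monoˡ-≤ _ (ℕ.+-monoʳ-≤ 2 c≤P) ⟩
      offset + (t₁ + t₂ + offset)  ≡⟨ solve 3 (λ t₁ t₂ o →
           o :+ (t₁ :+ t₂ :+ o) := (t₁ :+ o) :+ (t₂ :+ o)) refl t₁ t₂ offset ⟩
      (t₁ + offset) + (t₂ + offset) ∎
      where
      open ℕ.≤-Reasoning
      open ℕ-Solver

    mutual
      -- At level `l` there remain `suc j` = k + 2 - l terms to spend. The induction is on the size
      -- bound `m`; `call-bounded` speaks of the instance before reduction, `node-bounded` of the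
      -- one after it.
      call-bounded : ∀ m l j I C* a → l + suc j ≡ 2 + k → size k G I ≤ m → Level k G l I →
        Bounded (suc j) (size k G I) (padded I C* a)
      call-bounded m l j I C* a l+j≡ size≤ level with ⟶*-≡⊎size-< k G (reduces I)
      -- The level may be gone: restart at level 0 with the full sum, and charge it to the lost unit
      -- of size.
      ... | inj₂ shrunk =
        shrink-bounded {j} {size k G (reduce I)}
          (unweighted {2 + k} dominates
            (node-bounded m 0 k I C* a refl (ℕ.<⇒≤ (ℕ.<-≤-trans shrunk size≤)) (inj₁ z≤n)))
          shrunk
      -- One term left means level k + 1, at which the reduction cannot have been idle.
      call-bounded m l zero I C* a l+1≡ size≤ level | inj₁ reduce≡ =
        contradiction (subst (λ l → Level k G l I) (ℕ.suc-injective (trans (ℕ.+-comm 1 l) l+1≡)) level)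
          (irreducible⇒¬level k G {I} (subst (Irreducible k G) reduce≡ (irreducible I)))
      call-bounded m l (suc j) I C* a l+j≡ size≤ level | inj₁ reduce≡ =
        subst (λ s → Bounded (2 + j) s (padded I C* a)) (cong (size k G) reduce≡)
          (node-bounded m l j I C* a l+j≡
            (subst (λ J → size k G J ≤ m) (sym reduce≡) size≤)
            (subst (Level k G l) (sym reduce≡) level))

      node-bounded : ∀ m l j I C* a → l + suc (suc j) ≡ 2 + k →
        size k G (reduce I) ≤ m → Level k G l (reduce I) →
        Bounded (2 + j) (size k G (reduce I)) (padded I C* a)
      node-bounded m l j I C* a l+j≡ size≤ level with BB-unfold I C* a
      ... | inj₁ t≡ = leaf-bounded (suc j) (size k G (reduce I))
              (fromℕ-mono-≤ {time I C* a + offset} {offset + offset}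
              (ℕ.+-monoˡ-≤ offset (subst (_≤ offset) (sym t≡) (ℕ.m≤n⇒m≤o+n 2 (cost≤P I C*)))))
      node-bounded zero l j I C* a l+j≡ size≤ level | inj₂ (b , br , _) =
        contradiction (ℕ.<-≤-trans (include-size k G (reduce I) (irreducible I) b br) size≤) λ ()
      node-bounded (suc m) l j I C* a l+j≡ size≤ level | inj₂ (b , br , a₁ , C₁ , a₂ , t≡) =
        branch-bounded {suc j} {s₂ = size k G I₂}
          (begin
            fromℕ (time I C* a + offset)
              ≡⟨ cong (λ t → fromℕ (t + offset)) t≡ ⟩
            fromℕ (cost I C* + suc t₁ + suc t₂ + offset)
              ≤⟨ fromℕ-mono-≤ {cost I C* + suc t₁ + suc t₂ + offset} {(t₁ + offset) + (t₂ + offset)}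
                   (node-offset (cost I C*) t₁ t₂ (cost≤P I C*)) ⟩
            fromℕ ((t₁ + offset) + (t₂ + offset))
              ≡⟨ fromℕ-+ (t₁ + offset) (t₂ + offset) ⟩
            fromℕ (t₁ + offset) ℚ.+ fromℕ (t₂ + offset) ∎)
          -- The left child continues the chain with one level more and one term fewer; the right
          -- child starts a new chain at level 0.
          (call-bounded m (suc l) j I₁ C* a₁ (trans (sym (ℕ.+-suc l (suc j))) l+j≡)
            (ℕ.≤-pred (ℕ.≤-trans s₁< size≤))
            (include-level k G J (irreducible I) b br level))
          (unweighted {2 + k} dominates
            (call-bounded m 0 (suc k) I₂ C₁ a₂ refl
              (ℕ.≤-pred (ℕ.≤-trans s₂< size≤)) (inj₁ z≤n)))
          s₁< s₂<
        where
        open ℚ.≤-Reasoning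
        J   = reduce I
        I₁  = include k G J (irreducible I) b br
        I₂  = exclude k G J b br
        t₁  = time I₁ C* a₁
        t₂  = time I₂ C₁ a₂
        s₁< = include-size k G J (irreducible I) b br
        s₂< = exclude-size k G J b br

    running-time-bounded : fromℕ (running-time k G A) ℚ.≤ fromℕ (offset + offset) ℚ.* fromℕ 4 ℚ.* x ^ n
    running-time-bounded = begin
      fromℕ (suc (time I₀ ⊥ a₀))
        ≤⟨ fromℕ-mono-≤ {suc t₀} {t₀ + offset}
             (ℕ.≤-trans (s≤s (ℕ.m≤m+n t₀ (suc P))) (ℕ.≤-reflexive (sym (ℕ.+-suc t₀ (suc P))))) ⟩
      padded I₀ ⊥ a₀
        ≤⟨ unweighted {2 + k} dominates
             (call-bounded (size k G I₀) 0 (suc k) I₀ ⊥ a₀ refl ℕ.≤-refl (inj₁ z≤n)) ⟩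
      K ℚ.* x ^ size k G I₀
        ≤⟨ *-monoˡ-≤ 0≤K (^-monoʳ-≤ 1≤x (∣p∣≤n (Instance.V I₀ ─ Instance.S I₀))) ⟩
      K ℚ.* x ^ n ∎
      where
      open ℚ.≤-Reasoning
      I₀ = initial k G
      a₀ = <-wellFounded (size k G I₀)
      t₀ = time I₀ ⊥ a₀

-- Absolute values and small powers of ½.

∣p∣≤q : ∀ {p q} → p ℚ.≤ q → ℚ.- p ℚ.≤ q → ℚ.∣ p ∣ ℚ.≤ q
∣p∣≤q {p} {q} p≤q -p≤q with ℚ.∣p∣≡p∨∣p∣≡-p p
... | inj₁ ∣p∣≡p  = subst (ℚ._≤ q) (sym ∣p∣≡p) p≤q
... | inj₂ ∣p∣≡-p = subst (ℚ._≤ q) (sym ∣p∣≡-p) -p≤q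

p≤∣p∣ : ∀ p → p ℚ.≤ ℚ.∣ p ∣
p≤∣p∣ p with ℚ.≤-total 0ℚ p
... | inj₁ 0≤p = ℚ.≤-reflexive (sym (ℚ.0≤p⇒∣p∣≡p 0≤p))
... | inj₂ p≤0 = ℚ.≤-trans p≤0 (ℚ.0≤∣p∣ p)

-p≤∣p∣ : ∀ p → ℚ.- p ℚ.≤ ℚ.∣ p ∣
-p≤∣p∣ p = subst (ℚ.- p ℚ.≤_) (ℚ.∣-p∣≡∣p∣ p) (p≤∣p∣ (ℚ.- p))

p≤q⇒0≤q-p : ∀ {p q} → p ℚ.≤ q → 0ℚ ℚ.≤ q ℚ.- p
p≤q⇒0≤q-p {p} {q} p≤q = subst (ℚ._≤ q ℚ.- p) (ℚ.+-inverseʳ p) (ℚ.+-monoˡ-≤ (ℚ.- p) p≤q)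

0≤q-p⇒p≤q : ∀ {p q} → 0ℚ ℚ.≤ q ℚ.- p → p ℚ.≤ q
0≤q-p⇒p≤q {p} {q} 0≤ = begin
  p                 ≤⟨ p≤q+p 0≤ ⟩
  (q ℚ.- p) ℚ.+ p   ≡⟨ solve 2 (λ p q → (q :- p) :+ p := q) refl p q ⟩
  q                 ∎
  where
  open ℚ.≤-Reasoning
  open +-*-Solver

archimedean : ∀ q → ∃[ N ] q ℚ.≤ fromℕ N
archimedean (mkℚ (+ a) d c) = a , subst (mkℚ (+ a) d c ℚ.≤_) (sym (fromℕ-mkℚ a))
  (*≤* (ℤ.*-monoˡ-≤-nonNeg (+ a) (+≤+ (s≤s z≤n))))
archimedean (mkℚ -[1+ a ] d c) = 0 , *≤* -≤+

0≤½ : 0ℚ ℚ.≤ ½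
0≤½ = ℚ.nonNegative⁻¹ ½

-- This is m ≤ 2ᵐ without division; it makes ½ᴺ ≤ ε for any natural N ≥ 1/ε.
½^-small : ∀ m → ½ ^ m ℚ.* fromℕ m ℚ.≤ 1ℚ
½^-small zero    = 0≤1
½^-small (suc m) = begin
  ½ ℚ.* ½ ^ m ℚ.* fromℕ (1 + m)
    ≡⟨ cong (½ ℚ.* ½ ^ m ℚ.*_) (fromℕ-+ 1 m) ⟩
  ½ ℚ.* ½ ^ m ℚ.* (1ℚ ℚ.+ fromℕ m)
    ≡⟨ solve 3 (λ h p m → h :* p :* (con 1ℚ :+ m) := h :* p :+ h :* (p :* m)) refl ½ (½ ^ m) (fromℕ m) ⟩
  ½ ℚ.* ½ ^ m ℚ.+ ½ ℚ.* (½ ^ m ℚ.* fromℕ m)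
    ≤⟨ ℚ.+-mono-≤ (*-monoˡ-≤ 0≤½ (½^≤1 m)) (*-monoˡ-≤ 0≤½ (½^-small m)) ⟩
  ½ ℚ.* 1ℚ ℚ.+ ½ ℚ.* 1ℚ
    ≡⟨⟩
  1ℚ ∎
  where
  open ℚ.≤-Reasoning
  open +-*-Solver
  ½^≤1 : ∀ m → ½ ^ m ℚ.≤ 1ℚ
  ½^≤1 zero    = ℚ.≤-refl
  ½^≤1 (suc m) = *-mono-≤ 0≤1 (^-nonNeg m 0≤½) (toWitness {a? = ½ ℚ.≤? 1ℚ} _) (½^≤1 m)

½^→0 : ∀ ε → 0ℚ ℚ.< ε → ∃[ N ] ½ ^ N ℚ.≤ ε
½^→0 ε 0<ε = N , (begin
    ½ ^ N                          ≡⟨ ℚ.*-identityʳ (½ ^ N) ⟨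
    ½ ^ N ℚ.* 1ℚ                   ≡⟨ cong (½ ^ N ℚ.*_) εδ≡1 ⟨
    ½ ^ N ℚ.* (ε ℚ.* δ)            ≤⟨ *-monoˡ-≤ (^-nonNeg N 0≤½) (*-monoˡ-≤ (ℚ.<⇒≤ 0<ε) δ≤N) ⟩
    ½ ^ N ℚ.* (ε ℚ.* fromℕ N)      ≡⟨ solve 3 (λ p e n → p :* (e :* n) := e :* (p :* n)) refl (½ ^ N) ε (fromℕ N) ⟩
    ε ℚ.* (½ ^ N ℚ.* fromℕ N)      ≤⟨ *-monoˡ-≤ (ℚ.<⇒≤ 0<ε) (½^-small N) ⟩
    ε ℚ.* 1ℚ                       ≡⟨ ℚ.*-identityʳ ε ⟩
    ε                              ∎)
  where
  open ℚ.≤-Reasoning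
  open +-*-Solver
  inverse = scale ε 1ℚ 0<ε (ℚ.positive⁻¹ 1ℚ)
  δ    = proj₁ inverse
  εδ≡1 = proj₂ (proj₂ inverse)
  N    = proj₁ (archimedean δ)
  δ≤N  = proj₂ (archimedean δ)

seq-^ᴿ : ∀ x m i → seq (x ^ᴿ m) i ≡ seq x i ^ m
seq-^ᴿ x zero    i = refl
seq-^ᴿ x (suc m) i = cong (seq x i ℚ.*_) (seq-^ᴿ x m i)


-- Perturbation estimates for powers and geometric sums.

geom-telescope : ∀ x j → (x ℚ.- 1ℚ) ℚ.* geom x j ≡ x ^ j ℚ.- 1ℚ
geom-telescope x zero    = ℚ.*-zeroʳ (x ℚ.- 1ℚ)
geom-telescope x (suc j) = begin
  (x ℚ.- 1ℚ) ℚ.* (geom x j ℚ.+ x ^ j)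
    ≡⟨ ℚ.*-distribˡ-+ (x ℚ.- 1ℚ) (geom x j) (x ^ j) ⟩
  (x ℚ.- 1ℚ) ℚ.* geom x j ℚ.+ (x ℚ.- 1ℚ) ℚ.* x ^ j
    ≡⟨ cong (ℚ._+ (x ℚ.- 1ℚ) ℚ.* x ^ j) (geom-telescope x j) ⟩
  (x ^ j ℚ.- 1ℚ) ℚ.+ (x ℚ.- 1ℚ) ℚ.* x ^ j
    ≡⟨ solve 2 (λ x p → (p :- con 1ℚ) :+ (x :- con 1ℚ) :* p := x :* p :- con 1ℚ) refl x (x ^ j) ⟩
  x ℚ.* x ^ j ℚ.- 1ℚ ∎
  where
  open ≡-Reasoning
  open +-*-Solver

geom-scale : ∀ θ y j → 1ℚ ℚ.≤ θ → 0ℚ ℚ.≤ y →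
  geom (θ ℚ.* y) (suc j) ℚ.≤ θ ^ j ℚ.* geom y (suc j)
geom-scale θ y zero    1≤θ 0≤y = ℚ.≤-refl
geom-scale θ y (suc j) 1≤θ 0≤y = begin
  geom (θ ℚ.* y) (suc j) ℚ.+ (θ ℚ.* y) ^ suc j
    ≤⟨ ℚ.+-mono-≤
         (ℚ.≤-trans (geom-scale θ y j 1≤θ 0≤y)
           (*-monoʳ-≤ (geom-nonNeg (suc j) 0≤y) (^-monoʳ-≤ 1≤θ (ℕ.n≤1+n j))))
         (ℚ.≤-reflexive (^-distrib-* θ y (suc j))) ⟩
  θ ^ suc j ℚ.* geom y (suc j) ℚ.+ θ ^ suc j ℚ.* y ^ suc j
    ≡⟨ ℚ.*-distribˡ-+ (θ ^ suc j) (geom y (suc j)) (y ^ suc j) ⟨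
  θ ^ suc j ℚ.* geom y (suc (suc j)) ∎
  where open ℚ.≤-Reasoning

-- A crude converse of Bernoulli's inequality. With a = 3ⁿ ≥ 1 and t ≤ 1, each of t, at and at² is
-- at most at, whence the factor 3 per step.
bernoulli : ∀ t n → 0ℚ ℚ.≤ t → t ℚ.≤ 1ℚ → (1ℚ ℚ.+ t) ^ n ℚ.≤ 1ℚ ℚ.+ fromℕ 3 ^ n ℚ.* t
bernoulli t zero    0≤t t≤1 = p≤p+q (*-nonNeg 0≤1 0≤t)
bernoulli t (suc n) 0≤t t≤1 = begin
  (1ℚ ℚ.+ t) ℚ.* (1ℚ ℚ.+ t) ^ n
    ≤⟨ *-monoˡ-≤ (ℚ.+-mono-≤ 0≤1 0≤t) (bernoulli t n 0≤t t≤1) ⟩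
  (1ℚ ℚ.+ t) ℚ.* (1ℚ ℚ.+ a ℚ.* t)
    ≡⟨ solve 2 (λ t a → (con 1ℚ :+ t) :* (con 1ℚ :+ a :* t)
          := con 1ℚ :+ (con 1ℚ :* t :+ a :* t :+ a :* t :* t)) refl t a ⟩
  1ℚ ℚ.+ (1ℚ ℚ.* t ℚ.+ a ℚ.* t ℚ.+ a ℚ.* t ℚ.* t)
    ≤⟨ ℚ.+-monoʳ-≤ 1ℚ (ℚ.+-mono-≤
         (ℚ.+-monoˡ-≤ (a ℚ.* t) (*-monoʳ-≤ 0≤t (1≤x^n n (toWitness {a? = 1ℚ ℚ.≤? fromℕ 3} _))))
         (*-monoˡ-≤ (*-nonNeg (^-nonNeg n (0≤fromℕ 3)) 0≤t) t≤1)) ⟩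
  1ℚ ℚ.+ (a ℚ.* t ℚ.+ a ℚ.* t ℚ.+ a ℚ.* t ℚ.* 1ℚ)
    ≡⟨ solve 2 (λ t a → con 1ℚ :+ (a :* t :+ a :* t :+ a :* t :* con 1ℚ)
          := con 1ℚ :+ con (fromℕ 3) :* a :* t) refl t a ⟩
  1ℚ ℚ.+ fromℕ 3 ^ suc n ℚ.* t ∎
  where
  open ℚ.≤-Reasoning
  open +-*-Solver
  a = fromℕ 3 ^ n

^-lipschitz-constant : ℕ → ℚ
^-lipschitz-constant zero    = 0ℚ
^-lipschitz-constant (suc m) = fromℕ 2 ^ m ℚ.+ fromℕ 2 ℚ.* ^-lipschitz-constant m

^-lipschitz-constant-nonNeg : ∀ m → 0ℚ ℚ.≤ ^-lipschitz-constant m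
^-lipschitz-constant-nonNeg zero    = ℚ.≤-refl
^-lipschitz-constant-nonNeg (suc m) =
  ℚ.+-mono-≤ (^-nonNeg m (0≤fromℕ 2)) (*-nonNeg (0≤fromℕ 2) (^-lipschitz-constant-nonNeg m))

^-lipschitz : ∀ m {a d} → 0ℚ ℚ.≤ a → 0ℚ ℚ.≤ d → a ℚ.+ d ℚ.≤ fromℕ 2 →
  (a ℚ.+ d) ^ m ℚ.≤ a ^ m ℚ.+ ^-lipschitz-constant m ℚ.* d
^-lipschitz zero    {d = d} 0≤a 0≤d a+d≤2 =
  ℚ.≤-reflexive (sym (trans (cong (1ℚ ℚ.+_) (ℚ.*-zeroˡ d)) (ℚ.+-identityʳ 1ℚ)))
^-lipschitz (suc m) {a} {d} 0≤a 0≤d a+d≤2 = begin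
  (a ℚ.+ d) ℚ.* (a ℚ.+ d) ^ m
    ≤⟨ *-monoˡ-≤ (ℚ.+-mono-≤ 0≤a 0≤d) (^-lipschitz m 0≤a 0≤d a+d≤2) ⟩
  (a ℚ.+ d) ℚ.* (a ^ m ℚ.+ L ℚ.* d)
    ≡⟨ solve 4 (λ a d p l → (a :+ d) :* (p :+ l :* d)
          := a :* p :+ (p :* d :+ (a :+ d) :* (l :* d))) refl a d (a ^ m) L ⟩
  a ℚ.* a ^ m ℚ.+ (a ^ m ℚ.* d ℚ.+ (a ℚ.+ d) ℚ.* (L ℚ.* d))
    ≤⟨ ℚ.+-monoʳ-≤ (a ℚ.* a ^ m) (ℚ.+-mono-≤
         (*-monoʳ-≤ 0≤d (^-monoˡ-≤ m 0≤a (ℚ.≤-trans (p≤p+q 0≤d) a+d≤2)))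
         (*-monoʳ-≤ (*-nonNeg (^-lipschitz-constant-nonNeg m) 0≤d) a+d≤2)) ⟩
  a ℚ.* a ^ m ℚ.+ (fromℕ 2 ^ m ℚ.* d ℚ.+ fromℕ 2 ℚ.* (L ℚ.* d))
    ≡⟨ cong (a ℚ.* a ^ m ℚ.+_) (solve 4 (λ p d c l → p :* d :+ c :* (l :* d) := (p :+ c :* l) :* d)
         refl (fromℕ 2 ^ m) d (fromℕ 2) L) ⟩
  a ^ suc m ℚ.+ ^-lipschitz-constant (suc m) ℚ.* d ∎
  where
  open ℚ.≤-Reasoning
  open +-*-Solver
  L = ^-lipschitz-constant m

½^-≤ : ∀ N {n} → N ≤ n → ½ ^ n ℚ.≤ ½ ^ N
½^-≤ N N≤n = go (ℕ.≤⇒≤′ N≤n)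
  where
  step : ∀ h x → 0ℚ ℚ.≤ h → h ℚ.≤ 1ℚ → 0ℚ ℚ.≤ x → h ℚ.* x ℚ.≤ x
  step h x 0≤h h≤1 0≤x = subst (h ℚ.* x ℚ.≤_) (ℚ.*-identityˡ x) (*-monoʳ-≤ 0≤x h≤1)
  go : ∀ {n} → N ℕ.≤′ n → ½ ^ n ℚ.≤ ½ ^ N
  go ℕ.≤′-refl = ℚ.≤-refl
  go (ℕ.≤′-step {n} N≤n) = ℚ.≤-trans
    (step ½ (½ ^ n) 0≤½ (toWitness {a? = ½ ℚ.≤? 1ℚ} _) (^-nonNeg n 0≤½)) (go N≤n)

-- Bisection for a one-sidedly Lipschitz function on the rationals.

module Bisection
  (p : ℚ → ℚ) (a₀ h : ℚ) (B L : ℚ)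
  (0≤h : 0ℚ ℚ.≤ h) (h-halves : ∀ x → h ℚ.* x ℚ.+ h ℚ.* x ≡ x)
  (h^→0 : ∀ ε → 0ℚ ℚ.< ε → ∃[ N ] (∀ n → N ≤ n → h ^ n ℚ.≤ ε))
  (0≤a₀ : 0ℚ ℚ.≤ a₀) (a₀+1≤B : a₀ ℚ.+ h ℚ.* 1ℚ ℚ.≤ B)
  (pa₀≤0 : p a₀ ℚ.≤ 0ℚ) (0≤pb₀ : 0ℚ ℚ.≤ p (a₀ ℚ.+ h ℚ.* 1ℚ))
  (0≤L : 0ℚ ℚ.≤ L)
  (lipschitz : ∀ a d → 0ℚ ℚ.≤ a → 0ℚ ℚ.≤ d → a ℚ.+ d ℚ.≤ B → p (a ℚ.+ d) ℚ.≤ p a ℚ.+ L ℚ.* d)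
  where
  open ℚ.≤-Reasoning
  open +-*-Solver

  -- The left end moves to the midpoint exactly when `p` is nonpositive there, so `p` stays ≤ 0 at
  -- the left end and ≥ 0 at the right end.
  lower : ℕ → ℚ
  lower zero = a₀
  lower (suc n) with p (lower n ℚ.+ h ^ (2 + n)) ℚ.≤? 0ℚ
  ... | yes _ = lower n ℚ.+ h ^ (2 + n)
  ... | no  _ = lower n

  upper : ℕ → ℚ
  upper n = lower n ℚ.+ h ^ (1 + n)

  0≤h^ : ∀ n → 0ℚ ℚ.≤ h ^ n
  0≤h^ n = ^-nonNeg n 0≤h

  midpoint : ∀ n → lower n ℚ.+ h ^ (2 + n) ℚ.+ h ^ (2 + n) ≡ upper n
  midpoint n = trans (ℚ.+-assoc (lower n) (h ^ (2 + n)) (h ^ (2 + n)))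
    (cong (lower n ℚ.+_) (h-halves (h ^ (1 + n))))

  lower-suc : ∀ n → lower n ℚ.≤ lower (suc n)
  lower-suc n with p (lower n ℚ.+ h ^ (2 + n)) ℚ.≤? 0ℚ
  ... | yes _ = p≤p+q (0≤h^ (2 + n))
  ... | no  _ = ℚ.≤-refl

  upper-suc : ∀ n → upper (suc n) ℚ.≤ upper n
  upper-suc n with p (lower n ℚ.+ h ^ (2 + n)) ℚ.≤? 0ℚ
  ... | yes _ = ℚ.≤-reflexive (midpoint n)
  ... | no  _ = ℚ.≤-trans (p≤p+q (0≤h^ (2 + n))) (ℚ.≤-reflexive (midpoint n))

  p-lower≤0 : ∀ n → p (lower n) ℚ.≤ 0ℚ
  p-lower≤0 zero = pa₀≤0
  p-lower≤0 (suc n) with p (lower n ℚ.+ h ^ (2 + n)) ℚ.≤? 0ℚ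
  ... | yes ≤0 = ≤0
  ... | no  _  = p-lower≤0 n

  0≤p-upper : ∀ n → 0ℚ ℚ.≤ p (upper n)
  0≤p-upper zero = 0≤pb₀
  0≤p-upper (suc n) with p (lower n ℚ.+ h ^ (2 + n)) ℚ.≤? 0ℚ
  ... | yes _  = subst (λ u → 0ℚ ℚ.≤ p u) (sym (midpoint n)) (0≤p-upper n)
  ... | no  ≰0 = ℚ.<⇒≤ (ℚ.≰⇒> ≰0)

  lower-mono : ∀ {m n} → m ℕ.≤′ n → lower m ℚ.≤ lower n
  lower-mono ℕ.≤′-refl           = ℚ.≤-refl
  lower-mono (ℕ.≤′-step {n} m≤n) = ℚ.≤-trans (lower-mono m≤n) (lower-suc n)

  upper-antimono : ∀ {m n} → m ℕ.≤′ n → upper n ℚ.≤ upper m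
  upper-antimono ℕ.≤′-refl           = ℚ.≤-refl
  upper-antimono (ℕ.≤′-step {n} m≤n) = ℚ.≤-trans (upper-suc n) (upper-antimono m≤n)

  a₀≤lower : ∀ n → a₀ ℚ.≤ lower n
  a₀≤lower n = lower-mono {0} {n} ℕ.z≤′n

  lower-gap : ∀ {N m n} → N ≤ m → N ≤ n → lower m ℚ.- lower n ℚ.≤ h ^ (1 + N)
  lower-gap {N} {m} {n} N≤m N≤n = begin
    lower m ℚ.- lower n
      ≤⟨ ℚ.+-mono-≤ (ℚ.≤-trans (p≤p+q {lower m} (0≤h^ (1 + m))) (upper-antimono {N} {m} (ℕ.≤⇒≤′ N≤m)))
                    (ℚ.neg-antimono-≤ (lower-mono {N} {n} (ℕ.≤⇒≤′ N≤n))) ⟩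
    upper N ℚ.- lower N
      ≡⟨ solve 2 (λ a d → a :+ d :- a := d) refl (lower N) (h ^ (1 + N)) ⟩
    h ^ (1 + N) ∎

  lower-cauchy : IsCauchy lower
  lower-cauchy ε 0<ε with h^→0 ε 0<ε
  ... | N , h^≤ε = N , λ m n N≤m N≤n → ∣p∣≤q
    (ℚ.≤-trans (lower-gap {N} {m} {n} N≤m N≤n) (h^≤ε (1 + N) (ℕ.n≤1+n N)))
    (subst (ℚ._≤ ε) (solve 2 (λ a b → b :- a := :- (a :- b)) refl (lower m) (lower n))
      (ℚ.≤-trans (lower-gap {N} {n} {m} N≤n N≤m) (h^≤ε (1 + N) (ℕ.n≤1+n N))))

  -- Since `p` is nonnegative at the right end, its depth at the left end is at most its rise across
  -- the interval.
  -p-lower≤ : ∀ n → ℚ.- p (lower n) ℚ.≤ L ℚ.* h ^ (1 + n)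
  -p-lower≤ n = begin
    ℚ.- p (lower n)
      ≤⟨ p≤q+p (0≤p-upper n) ⟩
    p (upper n) ℚ.- p (lower n)
      ≤⟨ ℚ.+-monoˡ-≤ (ℚ.- p (lower n)) (lipschitz (lower n) (h ^ (1 + n))
           (ℚ.≤-trans 0≤a₀ (a₀≤lower n)) (0≤h^ (1 + n))
           (ℚ.≤-trans (upper-antimono {0} {n} ℕ.z≤′n) a₀+1≤B)) ⟩
    (p (lower n) ℚ.+ L ℚ.* h ^ (1 + n)) ℚ.- p (lower n)
      ≡⟨ solve 2 (λ a d → a :+ d :- a := d) refl (p (lower n)) (L ℚ.* h ^ (1 + n)) ⟩
    L ℚ.* h ^ (1 + n) ∎

  root-vanishes : ∀ ε → 0ℚ ℚ.< ε → ∃[ N ] (∀ n → N ≤ n → ℚ.∣ p (lower n) ∣ ℚ.≤ ε)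
  root-vanishes ε 0<ε
    -- `scale` needs a positive factor, and `L` is only nonnegative.
    with scale (1ℚ ℚ.+ L) ε (ℚ.+-mono-<-≤ (ℚ.positive⁻¹ 1ℚ) 0≤L) 0<ε
  ... | δ , 0<δ , Bδ≡ε with h^→0 δ 0<δ
  ...   | N , h^≤δ = N , λ n N≤n →
    ∣p∣≤q (ℚ.≤-trans (p-lower≤0 n) (ℚ.<⇒≤ 0<ε)) (begin
      ℚ.- p (lower n)      ≤⟨ -p-lower≤ n ⟩
      L ℚ.* h ^ (1 + n)    ≤⟨ *-mono-≤ (ℚ.+-mono-≤ 0≤1 0≤L) (0≤h^ (1 + n)) (p≤q+p {L} 0≤1)
                                (h^≤δ (1 + n) (ℕ.m≤n⇒m≤1+n N≤n)) ⟩
      (1ℚ ℚ.+ L) ℚ.* δ     ≡⟨ Bδ≡ε ⟩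
      ε                    ∎)

  bracketed-root : Σ[ r ∈ ℝ ] (∀ n → a₀ ℚ.≤ seq r n)
    × (∀ ε → 0ℚ ℚ.< ε → ∃[ N ] (∀ n → N ≤ n → ℚ.∣ p (seq r n) ∣ ℚ.≤ ε))
  bracketed-root = mkℝ lower lower-cauchy , a₀≤lower , root-vanishes

-- A root of the branching polynomial that is at least 3/2.

1½ : ℚ
1½ = 1ℚ ℚ.+ ½

module _ (k : ℕ) where

  charPoly : ℚ → ℚ
  charPoly x = x ^ (3 + k) ℚ.- fromℕ 2 ℚ.* x ^ (2 + k) ℚ.+ 1ℚ

  seq-branchingPoly : ∀ x i → seq (branchingPoly k x) i ≡ charPoly (seq x i)
  seq-branchingPoly x i = cong₂ (λ a b → a ℚ.- fromℕ 2 ℚ.* b ℚ.+ 1ℚ)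
    (trans (seq-^ᴿ x (k + 3) i) (cong (seq x i ^_) (ℕ.+-comm k 3)))
    (trans (seq-^ᴿ x (k + 2) i) (cong (seq x i ^_) (ℕ.+-comm k 2)))

  charPoly-factored : ∀ x → charPoly x ≡ 1ℚ ℚ.- x ^ (2 + k) ℚ.* (fromℕ 2 ℚ.- x)
  charPoly-factored x =
    solve 3 (λ x p c → x :* p :- c :* p :+ con 1ℚ := con 1ℚ :- p :* (c :- x)) refl x (x ^ (2 + k)) (fromℕ 2)
    where open +-*-Solver

  -- For x ≥ 1 the exponent can be lowered to 2, which gives a criterion independent of `k`.
  charPoly≤0 : ∀ x → 1ℚ ℚ.≤ x → 0ℚ ℚ.≤ fromℕ 2 ℚ.- x → 1ℚ ℚ.≤ x ^ 2 ℚ.* (fromℕ 2 ℚ.- x) →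
    charPoly x ℚ.≤ 0ℚ
  charPoly≤0 x 1≤x 0≤2-x 1≤ = begin
    charPoly x
      ≡⟨ charPoly-factored x ⟩
    1ℚ ℚ.- x ^ (2 + k) ℚ.* (fromℕ 2 ℚ.- x)
      ≤⟨ ℚ.+-mono-≤ 1≤ (ℚ.neg-antimono-≤
           (*-monoʳ-≤ 0≤2-x (^-monoʳ-≤ {x} {2} {2 + k} 1≤x (ℕ.m≤m+n 2 k)))) ⟩
    x ^ 2 ℚ.* (fromℕ 2 ℚ.- x) ℚ.- x ^ 2 ℚ.* (fromℕ 2 ℚ.- x)
      ≡⟨ ℚ.+-inverseʳ (x ^ 2 ℚ.* (fromℕ 2 ℚ.- x)) ⟩
    0ℚ ∎
    where open ℚ.≤-Reasoning

  0≤charPoly-2 : ∀ x → fromℕ 2 ℚ.- x ≡ 0ℚ → 0ℚ ℚ.≤ charPoly x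
  0≤charPoly-2 x 2-x≡0 = subst (0ℚ ℚ.≤_)
    (sym (trans (charPoly-factored x)
      (cong (λ q → 1ℚ ℚ.- q) (trans (cong (x ^ (2 + k) ℚ.*_) 2-x≡0) (ℚ.*-zeroʳ (x ^ (2 + k)))))))
    0≤1

  -- The term with negative sign only falls, so the leading power alone limits the rise.
  charPoly-lipschitz : ∀ a d → 0ℚ ℚ.≤ a → 0ℚ ℚ.≤ d → a ℚ.+ d ℚ.≤ fromℕ 2 →
    charPoly (a ℚ.+ d) ℚ.≤ charPoly a ℚ.+ ^-lipschitz-constant (3 + k) ℚ.* d
  charPoly-lipschitz a d 0≤a 0≤d a+d≤2 = begin
    charPoly (a ℚ.+ d)
      ≤⟨ ℚ.+-monoˡ-≤ 1ℚ (ℚ.+-mono-≤ (^-lipschitz (3 + k) 0≤a 0≤d a+d≤2)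
           (ℚ.neg-antimono-≤ (*-monoˡ-≤ (0≤fromℕ 2) (^-monoˡ-≤ (2 + k) 0≤a (p≤p+q 0≤d))))) ⟩
    a ^ (3 + k) ℚ.+ L ℚ.* d ℚ.- fromℕ 2 ℚ.* a ^ (2 + k) ℚ.+ 1ℚ
      ≡⟨ solve 3 (λ p l q → p :+ l :- q :+ con 1ℚ := (p :- q :+ con 1ℚ) :+ l) refl
           (a ^ (3 + k)) (L ℚ.* d) (fromℕ 2 ℚ.* a ^ (2 + k)) ⟩
    charPoly a ℚ.+ L ℚ.* d ∎
    where
    open ℚ.≤-Reasoning
    open +-*-Solver
    L = ^-lipschitz-constant (3 + k)

  charPoly-root : Σ[ r ∈ ℝ ] (∀ n → 1½ ℚ.≤ seq r n)
    × (∀ ε → 0ℚ ℚ.< ε → ∃[ N ] (∀ n → N ≤ n → ℚ.∣ charPoly (seq r n) ∣ ℚ.≤ ε))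
  charPoly-root = Bisection.bracketed-root charPoly 1½ ½ (fromℕ 2) (^-lipschitz-constant (3 + k))
    0≤½ halves
    (λ ε 0<ε → let N , ½^N≤ε = ½^→0 ε 0<ε in N , λ n N≤n → ℚ.≤-trans (½^-≤ N N≤n) ½^N≤ε)
    (toWitness {a? = 0ℚ ℚ.≤? 1½} _) ℚ.≤-refl
    -- The last check is (3/2)² · 1/2 = 9/8 ≥ 1.
    (charPoly≤0 1½
      (toWitness {a? = 1ℚ ℚ.≤? 1½} _)
      (toWitness {a? = 0ℚ ℚ.≤? fromℕ 2 ℚ.- 1½} _)
      (toWitness {a? = 1ℚ ℚ.≤? 1½ ^ 2 ℚ.* (fromℕ 2 ℚ.- 1½)} _))
    (0≤charPoly-2 (1½ ℚ.+ ½ ℚ.* 1ℚ) refl)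
    (^-lipschitz-constant-nonNeg (3 + k)) charPoly-lipschitz

  -- Separates the largest root from the trivial root 1.
  root≥1½ : Σ[ r ∈ ℝ ] (∀ n → 1½ ℚ.≤ seq r n) × branchingPoly k r ≃ᴿ fromℕᴿ 0
  root≥1½ = r , 1½≤r , λ ε 0<ε → proj₁ (vanishes ε 0<ε) , λ n N≤n → subst (λ q → ℚ.∣ q ∣ ℚ.≤ ε)
      (sym (trans (ℚ.+-identityʳ (seq (branchingPoly k r) n)) (seq-branchingPoly r n)))
      (proj₂ (vanishes ε 0<ε) n N≤n)
    where
    r        = proj₁ charPoly-root
    1½≤r     = proj₁ (proj₂ charPoly-root)
    vanishes = proj₂ (proj₂ charPoly-root)

-- 24 = 2 · 3 · 4: two offsets, each at most 3P because P ≥ 1, times the 4 in `K`.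
time-constant≤ : ∀ P → 1 ≤ P → fromℕ ((2 + P) + (2 + P)) ℚ.* fromℕ 4 ℚ.≤ fromℕ 24 ℚ.* fromℕ P
time-constant≤ P 1≤P = begin
  fromℕ ((2 + P) + (2 + P)) ℚ.* fromℕ 4
    ≡⟨ fromℕ-* ((2 + P) + (2 + P)) 4 ⟨
  fromℕ (((2 + P) + (2 + P)) * 4)
    ≤⟨ fromℕ-mono-≤ {((2 + P) + (2 + P)) * 4} {24 * P} ℕ-bound ⟩
  fromℕ (24 * P)
    ≡⟨ fromℕ-* 24 P ⟩
  fromℕ 24 ℚ.* fromℕ P ∎
  where
  open ℚ.≤-Reasoning
  2+P≤3P : 2 + P ≤ 3 * P
  2+P≤3P = ℕ.≤-trans (ℕ.+-monoˡ-≤ P (ℕ.*-monoʳ-≤ 2 1≤P)) (ℕ.≤-reflexive (ℕ.+-comm (2 * P) P))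
  open ℕ-Solver
  ℕ-bound : ((2 + P) + (2 + P)) * 4 ≤ 24 * P
  ℕ-bound = ℕ.≤-trans (ℕ.*-monoˡ-≤ 4 (ℕ.+-mono-≤ 2+P≤3P 2+P≤3P))
    (ℕ.≤-reflexive
      (solve 1 (λ p → (con 3 :* p :+ con 3 :* p) :* con 4 := con 24 :* p) refl P))

-- From rational bases to the real root.

¼ : ℚ
¼ = ½ ℚ.* ½

0≤¼ : 0ℚ ℚ.≤ ¼
0≤¼ = ℚ.nonNegative⁻¹ ¼

module _ (k : ℕ) where
  open ℚ.≤-Reasoning
  open +-*-Solver

  -- With Y = yᵏ⁺² one has (y - 1) · geom = Y - 1 = (y - 1)Y - p(y), which is at most (y - 1)Y + δ.
  -- As (y - 1)Y ≥ 1/4, the defect δ is at most 4δ(y - 1)Y, and y - 1 cancels.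
  perturbed-dominates : ∀ y δ → 1ℚ ℚ.+ ¼ ℚ.≤ y → 0ℚ ℚ.≤ δ → ℚ.- charPoly k y ℚ.≤ δ →
    geom y (2 + k) ℚ.≤ (1ℚ ℚ.+ fromℕ 4 ℚ.* δ) ℚ.* y ^ (2 + k)
  perturbed-dominates y δ 1¼≤y 0≤δ -p≤δ = ℚ.*-cancelˡ-≤-pos (y ℚ.- 1ℚ) {{ℚ.positive 0<y-1}} (begin
    (y ℚ.- 1ℚ) ℚ.* geom y (2 + k)
      ≡⟨ geom-telescope y (2 + k) ⟩
    Y ℚ.- 1ℚ
      ≤⟨ p≤q+p (p≤q⇒0≤q-p -p≤δ) ⟩
    (δ ℚ.- ℚ.- charPoly k y) ℚ.+ (Y ℚ.- 1ℚ)
      ≡⟨ solve 3 (λ d y p → (d :- (:- (y :* p :- con (fromℕ 2) :* p :+ con 1ℚ))) :+ (p :- con 1ℚ)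
           := (y :- con 1ℚ) :* p :+ con (fromℕ 4) :* d :* (con ¼ :* con 1ℚ)) refl δ y Y ⟩
    (y ℚ.- 1ℚ) ℚ.* Y ℚ.+ fromℕ 4 ℚ.* δ ℚ.* (¼ ℚ.* 1ℚ)
      ≤⟨ ℚ.+-monoʳ-≤ ((y ℚ.- 1ℚ) ℚ.* Y) (*-monoˡ-≤ (*-nonNeg (0≤fromℕ 4) 0≤δ)
           (*-mono-≤ (ℚ.<⇒≤ 0<y-1) 0≤1 ¼≤y-1 (1≤x^n (2 + k) 1≤y))) ⟩
    (y ℚ.- 1ℚ) ℚ.* Y ℚ.+ fromℕ 4 ℚ.* δ ℚ.* ((y ℚ.- 1ℚ) ℚ.* Y)
      ≡⟨ solve 4 (λ d y p f → (y :- con 1ℚ) :* p :+ f :* d :* ((y :- con 1ℚ) :* p)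
           := (y :- con 1ℚ) :* ((con 1ℚ :+ f :* d) :* p)) refl δ y Y (fromℕ 4) ⟩
    (y ℚ.- 1ℚ) ℚ.* ((1ℚ ℚ.+ fromℕ 4 ℚ.* δ) ℚ.* Y) ∎)
    where
    Y = y ^ (2 + k)
    1≤y : 1ℚ ℚ.≤ y
    1≤y = ℚ.≤-trans (p≤p+q 0≤¼) 1¼≤y
    ¼≤y-1 : ¼ ℚ.≤ y ℚ.- 1ℚ
    ¼≤y-1 = ℚ.+-monoˡ-≤ (ℚ.- 1ℚ) 1¼≤y
    0<y-1 : 0ℚ ℚ.< y ℚ.- 1ℚ
    0<y-1 = ℚ.<-≤-trans (ℚ.positive⁻¹ ¼) ¼≤y-1

  -- Rescaling by θ ≥ 1 absorbs a multiplicative defect, as the sum has lower degree.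
  scaled-dominates : ∀ θ y → 1ℚ ℚ.≤ θ → 0ℚ ℚ.≤ y → geom y (2 + k) ℚ.≤ θ ℚ.* y ^ (2 + k) →
    geom (θ ℚ.* y) (2 + k) ℚ.≤ (θ ℚ.* y) ^ (2 + k)
  scaled-dominates θ y 1≤θ 0≤y g≤ = begin
    geom (θ ℚ.* y) (2 + k)
      ≤⟨ geom-scale θ y (1 + k) 1≤θ 0≤y ⟩
    θ ^ (1 + k) ℚ.* geom y (2 + k)
      ≤⟨ *-monoˡ-≤ (^-nonNeg (1 + k) (ℚ.≤-trans 0≤1 1≤θ)) g≤ ⟩
    θ ^ (1 + k) ℚ.* (θ ℚ.* y ^ (2 + k))
      ≡⟨ solve 3 (λ a t b → a :* (t :* b) := (t :* a) :* b) refl (θ ^ (1 + k)) θ (y ^ (2 + k)) ⟩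
    θ ^ (2 + k) ℚ.* y ^ (2 + k)
      ≡⟨ ^-distrib-* θ y (2 + k) ⟨
    (θ ℚ.* y) ^ (2 + k) ∎

  -- From yᵏ⁺²(2 - y) = 1 - p(y) ≥ 1/2 first y ≤ 2 follows, then 2 - y ≥ 1/(2 · 2ᵏ⁺²). The explicit
  -- gap is needed because strict order of reals asks for a rational one.
  below-2 : ∀ y → 0ℚ ℚ.≤ y → charPoly k y ℚ.≤ ½ → y ℚ.+ ½ ^ (2 + k) ℚ.* ½ ℚ.≤ fromℕ 2
  below-2 y 0≤y p≤½ = 0≤q-p⇒p≤q (subst (0ℚ ℚ.≤_)
      (solve 3 (λ y e c → (c :- y) :- e := c :- (y :+ e)) refl y (½ ^ D ℚ.* ½) (fromℕ 2))
      (p≤q⇒0≤q-p gap))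
    where
    D = 2 + k

    ½≤ : ½ ℚ.≤ y ^ D ℚ.* (fromℕ 2 ℚ.- y)
    ½≤ = begin
      ½                                          ≡⟨⟩
      1ℚ ℚ.- ½                                   ≤⟨ ℚ.+-monoʳ-≤ 1ℚ (ℚ.neg-antimono-≤ p≤½) ⟩
      1ℚ ℚ.- charPoly k y                        ≡⟨ cong (λ q → 1ℚ ℚ.- q) (charPoly-factored k y) ⟩
      1ℚ ℚ.- (1ℚ ℚ.- y ^ D ℚ.* (fromℕ 2 ℚ.- y))  ≡⟨ solve 1 (λ q → con 1ℚ :- (con 1ℚ :- q) := q) refl
                                                      (y ^ D ℚ.* (fromℕ 2 ℚ.- y)) ⟩
      y ^ D ℚ.* (fromℕ 2 ℚ.- y)                  ∎

    y≤2 : y ℚ.≤ fromℕ 2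
    y≤2 with y ℚ.≤? fromℕ 2
    ... | yes y≤2 = y≤2
    ... | no  y≰2 = contradiction
      (ℚ.≤-trans ½≤ (ℚ.≤-trans
        (*-monoˡ-≤ (^-nonNeg D 0≤y) (ℚ.+-monoˡ-≤ (ℚ.- y) (ℚ.<⇒≤ (ℚ.≰⇒> y≰2))))
        (ℚ.≤-reflexive (trans (cong (y ^ D ℚ.*_) (ℚ.+-inverseʳ y)) (ℚ.*-zeroʳ (y ^ D))))))
      (toWitnessFalse {a? = ½ ℚ.≤? 0ℚ} _)

    ½^-2^ : ∀ m → ½ ^ m ℚ.* fromℕ 2 ^ m ≡ 1ℚ
    ½^-2^ m = trans (sym (^-distrib-* ½ (fromℕ 2) m)) (1^ m)
      where
      1^ : ∀ m → 1ℚ ^ m ≡ 1ℚ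
      1^ zero    = refl
      1^ (suc m) = trans (ℚ.*-identityˡ (1ℚ ^ m)) (1^ m)

    gap : ½ ^ D ℚ.* ½ ℚ.≤ fromℕ 2 ℚ.- y
    gap = begin
      ½ ^ D ℚ.* ½
        ≤⟨ *-monoˡ-≤ (^-nonNeg D 0≤½) (ℚ.≤-trans ½≤
             (*-monoʳ-≤ (p≤q⇒0≤q-p y≤2) (^-monoˡ-≤ D 0≤y y≤2))) ⟩
      ½ ^ D ℚ.* (fromℕ 2 ^ D ℚ.* (fromℕ 2 ℚ.- y))
        ≡⟨ ℚ.*-assoc (½ ^ D) (fromℕ 2 ^ D) (fromℕ 2 ℚ.- y) ⟨
      ½ ^ D ℚ.* fromℕ 2 ^ D ℚ.* (fromℕ 2 ℚ.- y)
        ≡⟨ cong (ℚ._* (fromℕ 2 ℚ.- y)) (½^-2^ D) ⟩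
      1ℚ ℚ.* (fromℕ 2 ℚ.- y)
        ≡⟨ ℚ.*-identityˡ (fromℕ 2 ℚ.- y) ⟩
      fromℕ 2 ℚ.- y ∎

  module _ (γ : ℝ) (γ-largest : IsLargestRoot (branchingPoly k) γ) where

    -- γ is at least a root whose terms are ≥ 3/2; this order holds up to any ε, and ε = 1/4 leaves
    -- terms ≥ 5/4, safely above 1.
    eventually-near : ∀ δ → 0ℚ ℚ.< δ → ∃[ N ] (∀ i → N ≤ i →
      1ℚ ℚ.+ ¼ ℚ.≤ seq γ i × ℚ.∣ charPoly k (seq γ i) ∣ ℚ.≤ δ)
    eventually-near δ 0<δ = N₁ ⊔ N₂ , λ i i≥ →
        1¼≤ i (ℕ.m⊔n≤o⇒m≤o N₁ N₂ i≥)
      , subst (λ q → ℚ.∣ q ∣ ℚ.≤ δ)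
          (trans (ℚ.+-identityʳ (seq (branchingPoly k γ) i)) (seq-branchingPoly k γ i))
          (proj₂ vanishes i (ℕ.m⊔n≤o⇒n≤o N₁ N₂ i≥))
      where
      r        = proj₁ (root≥1½ k)
      r≤γ      = proj₂ γ-largest r (proj₂ (proj₂ (root≥1½ k))) ¼ (ℚ.positive⁻¹ ¼)
      vanishes = proj₁ γ-largest δ 0<δ
      N₁       = proj₁ r≤γ
      N₂       = proj₁ vanishes
      1¼≤ : ∀ i → N₁ ≤ i → 1ℚ ℚ.+ ¼ ℚ.≤ seq γ i
      1¼≤ i i≥ = begin
        1ℚ ℚ.+ ¼                     ≡⟨⟩
        1½ ℚ.- ¼                     ≤⟨ ℚ.+-monoˡ-≤ (ℚ.- ¼) (proj₁ (proj₂ (root≥1½ k)) i) ⟩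
        seq r i ℚ.- ¼                ≤⟨ ℚ.+-monoˡ-≤ (ℚ.- ¼) (proj₂ r≤γ i i≥) ⟩
        seq γ i ℚ.+ ¼ ℚ.- ¼          ≡⟨ solve 2 (λ a b → a :+ b :- b := a) refl (seq γ i) ¼ ⟩
        seq γ i                      ∎

    1¼≤⇒0≤ : ∀ {y} → 1ℚ ℚ.+ ¼ ℚ.≤ y → 0ℚ ℚ.≤ y
    1¼≤⇒0≤ = ℚ.≤-trans (toWitness {a? = 0ℚ ℚ.≤? 1ℚ ℚ.+ ¼} _)

    largest-root<2 : γ <ᴿ fromℕᴿ 2
    largest-root<2 = ½ ^ (2 + k) ℚ.* ½ , *-pos (½^-pos (2 + k)) 0<½ , N , λ i i≥ →
        below-2 (seq γ i) (1¼≤⇒0≤ (proj₁ (near i i≥)))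
          (ℚ.≤-trans (p≤∣p∣ (charPoly k (seq γ i))) (proj₂ (near i i≥)))
      where
      0<½ : 0ℚ ℚ.< ½
      0<½ = ℚ.positive⁻¹ ½
      ½^-pos : ∀ m → 0ℚ ℚ.< ½ ^ m
      ½^-pos zero    = ℚ.positive⁻¹ 1ℚ
      ½^-pos (suc m) = *-pos 0<½ (½^-pos m)
      N    = proj₁ (eventually-near ½ 0<½)
      near = proj₂ (eventually-near ½ 0<½)

    -- Bounds in terms of all rationals x satisfying the root inequality pass to γ,
    -- since (1 + 4 δ) γᵢ is such an x as soon as the polynomial is within δ of 0 at γᵢ.
    bound-at-root : ∀ (T M : ℚ) (n : ℕ) → 0ℚ ℚ.≤ M →
      (∀ x → 1ℚ ℚ.≤ x → x ℚ.≤ fromℕ 4 → geom x (2 + k) ℚ.≤ x ^ (2 + k) → T ℚ.≤ M ℚ.* x ^ n) →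
      ∀ ε → 0ℚ ℚ.< ε → ∃[ N ] (∀ i → N ≤ i → T ℚ.≤ M ℚ.* seq γ i ^ n ℚ.+ ε)
    bound-at-root T M n 0≤M T≤ ε 0<ε = proj₁ near , λ i i≥ →
      bound (seq γ i) (proj₁ (proj₂ near i i≥)) (proj₂ (proj₂ near i i≥))
      where
      -- The coefficient of δ in the error made by `bernoulli` at t = 4δ, with yⁿ replaced by 2ⁿ.
      E = M ℚ.* (fromℕ 2 ^ n ℚ.* (fromℕ 3 ^ n ℚ.* fromℕ 4))

      0≤2^n : 0ℚ ℚ.≤ fromℕ 2 ^ n
      0≤2^n = ^-nonNeg n (0≤fromℕ 2)

      0≤E : 0ℚ ℚ.≤ E
      0≤E = *-nonNeg 0≤M (*-nonNeg 0≤2^n (*-nonNeg (^-nonNeg n (0≤fromℕ 3)) (0≤fromℕ 4)))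

      scaled = scale (1ℚ ℚ.+ E) ε (ℚ.+-mono-<-≤ (ℚ.positive⁻¹ 1ℚ) 0≤E) 0<ε
      δ₁ = proj₁ scaled
      -- `δ₁` keeps the error below ε; 1/4 gives 4δ ≤ 1, hence θ ≤ 2 and θy ≤ 4, and lets `below-2`
      -- apply.
      δ  = δ₁ ℚ.⊓ ¼

      0<δ : 0ℚ ℚ.< δ
      0<δ with ℚ.⊓-sel δ₁ ¼
      ... | inj₁ eq = subst (0ℚ ℚ.<_) (sym eq) (proj₁ (proj₂ scaled))
      ... | inj₂ eq = subst (0ℚ ℚ.<_) (sym eq) (ℚ.positive⁻¹ ¼)

      near = eventually-near δ 0<δ
      t = fromℕ 4 ℚ.* δ
      θ = 1ℚ ℚ.+ t

      0≤t : 0ℚ ℚ.≤ t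
      0≤t = *-nonNeg (0≤fromℕ 4) (ℚ.<⇒≤ 0<δ)

      t≤1 : t ℚ.≤ 1ℚ
      t≤1 = *-monoˡ-≤ (0≤fromℕ 4) (ℚ.p⊓q≤q δ₁ ¼)

      1≤θ : 1ℚ ℚ.≤ θ
      1≤θ = p≤p+q 0≤t

      Eδ≤ε : E ℚ.* δ ℚ.≤ ε
      Eδ≤ε = begin
        E ℚ.* δ              ≤⟨ *-mono-≤ (ℚ.+-mono-≤ 0≤1 0≤E) (ℚ.<⇒≤ 0<δ) (p≤q+p {E} 0≤1) (ℚ.p⊓q≤p δ₁ ¼) ⟩
        (1ℚ ℚ.+ E) ℚ.* δ₁    ≡⟨ proj₂ (proj₂ scaled) ⟩
        ε                    ∎

      bound : ∀ y → 1ℚ ℚ.+ ¼ ℚ.≤ y → ℚ.∣ charPoly k y ∣ ℚ.≤ δ → T ℚ.≤ M ℚ.* y ^ n ℚ.+ ε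
      bound y 1¼≤y ∣p∣≤δ = begin
        T
          ≤⟨ T≤ (θ ℚ.* y)
               (*-mono-≤ (ℚ.≤-trans 0≤1 1≤θ) 0≤1 1≤θ 1≤y)
               (*-mono-≤ (0≤fromℕ 2) 0≤y (ℚ.+-monoʳ-≤ 1ℚ t≤1) y≤2)
               (scaled-dominates θ y 1≤θ 0≤y (perturbed-dominates y δ 1¼≤y (ℚ.<⇒≤ 0<δ)
                 (ℚ.≤-trans (-p≤∣p∣ (charPoly k y)) ∣p∣≤δ))) ⟩
        M ℚ.* (θ ℚ.* y) ^ n
          ≡⟨ cong (M ℚ.*_) (^-distrib-* θ y n) ⟩
        M ℚ.* (θ ^ n ℚ.* y ^ n)
          ≤⟨ *-monoˡ-≤ 0≤M (*-monoʳ-≤ (^-nonNeg n 0≤y) (bernoulli t n 0≤t t≤1)) ⟩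
        M ℚ.* ((1ℚ ℚ.+ fromℕ 3 ^ n ℚ.* t) ℚ.* y ^ n)
          ≡⟨ solve 5 (λ M a f d p → M :* ((con 1ℚ :+ a :* (f :* d)) :* p)
               := M :* p :+ M :* (p :* (a :* f)) :* d) refl M (fromℕ 3 ^ n) (fromℕ 4) δ (y ^ n) ⟩
        M ℚ.* y ^ n ℚ.+ M ℚ.* (y ^ n ℚ.* (fromℕ 3 ^ n ℚ.* fromℕ 4)) ℚ.* δ
          ≤⟨ ℚ.+-monoʳ-≤ (M ℚ.* y ^ n) (*-monoʳ-≤ (ℚ.<⇒≤ 0<δ) (*-monoˡ-≤ 0≤M
               (*-monoʳ-≤ (*-nonNeg (^-nonNeg n (0≤fromℕ 3)) (0≤fromℕ 4)) (^-monoˡ-≤ n 0≤y y≤2)))) ⟩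
        M ℚ.* y ^ n ℚ.+ E ℚ.* δ
          ≤⟨ ℚ.+-monoʳ-≤ (M ℚ.* y ^ n) Eδ≤ε ⟩
        M ℚ.* y ^ n ℚ.+ ε ∎
        where
        0≤y : 0ℚ ℚ.≤ y
        0≤y = 1¼≤⇒0≤ 1¼≤y
        1≤y : 1ℚ ℚ.≤ y
        1≤y = ℚ.≤-trans (p≤p+q 0≤¼) 1¼≤y
        y≤2 : y ℚ.≤ fromℕ 2
        y≤2 = ℚ.≤-trans (p≤p+q (*-nonNeg (^-nonNeg (2 + k) 0≤½) 0≤½))
          (below-2 y 0≤y (ℚ.≤-trans (p≤∣p∣ (charPoly k y)) (ℚ.≤-trans ∣p∣≤δ
            (ℚ.≤-trans (ℚ.p⊓q≤q δ₁ ¼) (toWitness {a? = ¼ ℚ.≤? ½} _)))))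

    running-time-∈𝒪 : (A : ∀ {n} (G : Graph n) → Implementation k G) (P₁ : ℕ → ℕ) →
      (∀ {n} (G : Graph n) (I : Instance k G) (C* : Subset n) → Implementation.cost (A G) I C* ≤ P₁ n) →
      (λ G → running-time k G (A G)) ∈𝒪 (λ n → fromℕᴿ (P₁ n) *ᴿ γ ^ᴿ n)
    running-time-∈𝒪 A P₁ cost≤ = 24 , 0 , λ {n} _ G ε 0<ε →
      let P = P₁ n
          T = fromℕ (running-time k G (A G))
          -- Positivity of a single cost, taken at the initial instance, makes `P` at least 1.
          1≤P = ℕ.≤-trans (Implementation.cost-pos (A G) (initial k G) ⊥) (cost≤ G (initial k G) ⊥)
          M = fromℕ 24 ℚ.* fromℕ P
          N , T≤ = bound-at-root T M n (*-nonNeg (0≤fromℕ 24) (0≤fromℕ P))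
            (λ x 1≤x x≤4 dominates → ℚ.≤-trans
              (running-time-bounded k G (A G) P (cost≤ G) x 1≤x x≤4 dominates)
              (*-monoʳ-≤ (^-nonNeg n (ℚ.≤-trans 0≤1 1≤x)) (time-constant≤ P 1≤P)))
            ε 0<ε
      in N , λ i i≥ → subst (λ q → T ℚ.≤ q ℚ.+ ε)
        (trans (ℚ.*-assoc (fromℕ 24) (fromℕ P) (seq γ i ^ n))
          (cong (λ q → fromℕ 24 ℚ.* (fromℕ P ℚ.* q)) (sym (seq-^ᴿ γ n i))))
        (T≤ i i≥)

theorem3p5 : (k : ℕ) → 1 ≤ k →
    (γ : ℝ) → IsLargestRoot (branchingPoly k) γ →
    (A : ∀ {n} (G : Graph n) → Implementation k G) →
    (P₁ : ℕ → ℕ) →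
    (∀ {n} (G : Graph n) (I : Instance k G) (C* : Subset n) →
    Implementation.cost (A G) I C* ≤ P₁ n) →
    (γ <ᴿ fromℕᴿ 2)
    × ((λ G → running-time k G (A G)) ∈𝒪 (λ n → fromℕᴿ (P₁ n) *ᴿ γ ^ᴿ n))
    × (PolynomiallyBounded P₁ →
    (λ G → running-time k G (A G)) ∈𝒪* (λ n → γ ^ᴿ n))
theorem3p5 k _ γ γ-largest A P₁ cost≤ =
    largest-root<2 k γ γ-largest
  , running-time-∈𝒪 k γ γ-largest A P₁ cost≤
  , λ poly → P₁ , poly , running-time-∈𝒪 k γ γ-largest A P₁ cost≤
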